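{- Fix an integer $d\ge1$. There exist constants $c,\delta>0$ (depending on $d$) such that for the $d$-dimensional uniform torus with $n$ vertices (side length $n^{1/d}\in\mathbb{N}$) there exists an initial load vector such that, with probability $1-o(1)$ as $n\to\infty$, there are a vertex $v$ and a time $t$ with $|x^{(t)}_v-\xi^{(t)}_v|\ge c(\log n)^{\delta}$, where $x$ is produced by the randomized rounding diffusion algorithm and $\xi$ by the idealized process (i.e. the deviation is $\Omega(\mathrm{polylog}(n))$ with probability $1-o(1)$).
   Context: The uniform $d$-dimensional torus with $n$ vertices has vertex set $\{0,\dots,m-1\}^d$ with $m=n^{1/d}$, each vertex adjacent to the $2d$ vertices obtained by changing one coordinate by $\pm1 \bmod m$; $d$ is treated as a constant. Diffusion matrix $P$: $P_{i,j}=1/(4d)$ for adjacent $i,j$, $P_{i,i}=1/2$, $0$ otherwise. Idealized process: $\xi^{(t)}=\xi^{(t-1)}P$. Discrete process: integer loads with $x^{(t)}_i=x^{(t-1)}_i-\sum_{j:\{i,j\}\in E}\Phi^{(t)}_{i,j}$, $\Phi^{(t)}_{i,j}=-\Phi^{(t)}_{j,i}$ integers. Randomized rounding diffusion algorithm: for each edge and step, orient so that $y:=P_{i,j}x^{(t-1)}_i-P_{j,i}x^{(t-1)}_j\ge0$ and set $\Phi^{(t)}_{i,j}=\lceil y\rceil$ with probability $y-\lfloor y\rfloor$, else $\lfloor y\rfloor$, independently over edges and steps. Both processes start from $x^{(0)}=\xi^{(0)}$. -}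

module Defs where

open import Data.Nat as ℕ using (ℕ; zero; suc; NonZero; _^_)
open import Data.Nat.DivMod using (_%_; _/_; m%n<n)
open import Data.Nat.Logarithm using (⌊log₂_⌋)
open import Data.Integer as ℤ using (ℤ; +_)
import Data.Integer.Properties as ℤP
open import Data.Rational as ℚ using (ℚ; 0ℚ; 1ℚ)
open import Data.Rational.Properties using (_≤?_)
open import Data.Fin as Fin using (Fin; toℕ; fromℕ<)
open import Data.Fin.Properties using () renaming (_≟_ to _≟F_)
open import Data.Vec as Vec using (Vec; []; _∷_; updateAt)
open import Data.Vec.Properties using (≡-dec)
open import Data.List as List using (List; []; _∷_; allFin; concatMap)
open import Data.Bool.ListAction using (any)
open import Data.Product using (_×_; _,_)
open import Data.Bool using (Bool; true; false; if_then_else_)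
open import Relation.Nullary.Decidable using (⌊_⌋; yes; no)

Vertex : ℕ → ℕ → Set
Vertex m d = Vec (Fin m) d

allVertices : (m d : ℕ) → List (Vertex m d)
allVertices m zero    = [] ∷ []
allVertices m (suc d) = concatMap (λ i → List.map (i ∷_) (allVertices m d)) (allFin m)

incr : ∀ {m} → Fin m → Fin m
incr {suc m} i = fromℕ< (m%n<n (suc (toℕ i)) (suc m))

decr : ∀ {m} → Fin m → Fin m
decr {suc m} i = fromℕ< (m%n<n (toℕ i ℕ.+ m) (suc m))

shift+ : ∀ {m d} → Vertex m d → Fin d → Vertex m d
shift+ v k = updateAt v k incr

shift- : ∀ {m d} → Vertex m d → Fin d → Vertex m d
shift- v k = updateAt v k decr

-- Edges: the pairs {v, v + e_k}, one per vertex v and coordinate k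
-- (for m ≥ 3 these are exactly the edges of the torus, each listed once).
Edge : ℕ → ℕ → Set
Edge m d = Vertex m d × Fin d

edges : (m d : ℕ) → List (Edge m d)
edges m d = concatMap (λ v → List.map (v ,_) (allFin d)) (allVertices m d)

_≟V_ : ∀ {m d} → (u v : Vertex m d) → _
_≟V_ = ≡-dec _≟F_

Load : ℕ → ℕ → Set
Load m d = Vertex m d → ℤ

RLoad : ℕ → ℕ → Set
RLoad m d = Vertex m d → ℚ

nz4 : ∀ d → .{{NonZero d}} → NonZero (4 ℕ.* d)
nz4 (suc d) = _

sumℚ : List ℚ → ℚ
sumℚ = List.foldr ℚ._+_ 0ℚ

-- Idealized process: ξ ↦ ξ P with P_ii = 1/2 and P_ij = 1/(4d) for neighbours.
diffuse : ∀ {m} d → .{{NonZero d}} → RLoad m d → RLoad m d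
diffuse d ξ v =
  ξ v ℚ.* (+ 1 ℚ./ 2)
  ℚ.+ sumℚ (List.map (λ k → (ξ (shift+ v k) ℚ.+ ξ (shift- v k))
                           ℚ.* ((+ 1 ℚ./ (4 ℕ.* d)) {{nz4 d}}))
                     (allFin d))

addAt : ∀ {m d} → Load m d → Vertex m d → ℤ → Load m d
addAt x v a w = if ⌊ w ≟V v ⌋ then x w ℤ.+ a else x w

move : ∀ {m d} → Load m d → Vertex m d → Vertex m d → ℕ → Load m d
move x src dst f = addAt (addAt x src (ℤ.- (+ f))) dst (+ f)

-- One step of the randomized rounding diffusion algorithm, as an
-- expectation operator:  expStep d old es acc k  is the expected value of
-- k applied to the load vector obtained from acc by independently performing
-- the randomized-rounded transfers (computed from the old loads `old`)
-- on all edges in es.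
-- For the edge {v,u} (u = v + e_k) with weight P = 1/(4d): if x_v ≥ x_u the
-- edge is oriented v → u and y = (x_v - x_u)/(4d) ≥ 0, otherwise it is
-- oriented u → v with y = (x_u - x_v)/(4d) ≥ 0.  Writing the nonnegative
-- integer difference a = 4d·y = q·4d + r (0 ≤ r < 4d), ⌊y⌋ = q and
-- y - ⌊y⌋ = r/(4d); the flow is ⌈y⌉ = q+1 with probability r/(4d) (when
-- r = 0 this branch has probability 0) and ⌊y⌋ = q otherwise.
expStep : ∀ {m} d → .{{NonZero d}} → Load m d → List (Edge m d) → Load m d
          → (Load m d → ℚ) → ℚ
expStep d old []             acc κ = κ acc
expStep {m} d old ((v , k) ∷ es) acc κ = branch (old u ℤP.≤? old v)
  where
  u : Vertex m d
  u = shift+ v k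
  D : ℕ
  D = 4 ℕ.* d
  go : Vertex m d → Vertex m d → ℕ → ℚ
  go src dst a =
    let q = (a / D) {{nz4 d}}
        r = (a % D) {{nz4 d}}
        p = (+ r ℚ./ D) {{nz4 d}}
    in  p ℚ.* expStep d old es (move acc src dst (suc q)) κ
        ℚ.+ (1ℚ ℚ.- p) ℚ.* expStep d old es (move acc src dst q) κ
  branch : _ → ℚ
  branch (yes _) = go v u ℤ.∣ old v ℤ.- old u ∣
  branch (no _)  = go u v ℤ.∣ old u ℤ.- old v ∣

ℤtoℚ : ℤ → ℚ
ℤtoℚ z = z ℚ./ 1

powℚ : ℚ → ℕ → ℚ
powℚ x zero    = 1ℚ
powℚ x (suc k) = x ℚ.* powℚ x k

-- "some vertex v has |x_v - ξ_v| ≥ c (log n)^δ", in the form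
--   K · ⌊log₂ n⌋^p ≤ |x_v - ξ_v|^q    with n = m^d, K = c^q, δ = p/q.
bigDev : ∀ m d → (K : ℚ) (p q : ℕ) → Load m d → RLoad m d → Bool
bigDev m d K p q x ξ =
  any (λ v → ⌊ (K ℚ.* ℤtoℚ (+ (⌊log₂ (m ^ d) ⌋ ^ p)))
                 ≤? powℚ ℚ.∣ ℤtoℚ (x v) ℚ.- ξ v ∣ q ⌋)
      (allVertices m d)

indicator : Bool → ℚ
indicator true  = 1ℚ
indicator false = 0ℚ

hitProb : ∀ {m} d → .{{NonZero d}} → (K : ℚ) (p q : ℕ) → ℕ
          → Load m d → RLoad m d → ℚ
hitProb {m} d K p q zero    x ξ = indicator (bigDev m d K p q x ξ)
hitProb {m} d K p q (suc T) x ξ =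
  if bigDev m d K p q x ξ then 1ℚ
  else expStep d x (edges m d) x (λ x′ → hitProb d K p q T x′ (diffuse d ξ))

devProb : ∀ m d → .{{NonZero d}} → (K : ℚ) (p q : ℕ) → ℕ
          → (Vertex m d → ℕ) → ℚ
devProb m d K p q T x0 =
  hitProb d K p q T (λ v → + x0 v) (λ v → ℤtoℚ (+ x0 v))

{-# OPTIONS --safe #-}
module Submission where

-- The initial load of a block is linear in the first coordinate, with slope 2.  The ideal process
-- does not change it, away from the boundary of the block.  In the discrete process every edge along
-- that coordinate whose load difference is 1, 2 or 3 < 4d may carry 0 or 1 tokens, each with
-- probability at least 1/(4d).  Sending one token along all edges before a site s and none after it
-- raises the load of s by one, and while the deviation b from the linear profile satisfies
-- |b i - b (i + 1)| ≤ 1 all differences stay in {1, 2, 3}.  So about 2 W² additions can raise the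
-- centre by W.  Only edges in a box of side L ~ 4 W² matter, hence a block follows this script with
-- probability at least (4d)^(-E), where E = 2 W² · d L^d.  With W a small power of log m there are many
-- disjoint blocks, and the probability that all of them fail tends to 0; this is shown edge by edge,
-- with the product over the blocks of the conditional failure bounds as a supermartingale.

open import Defs
open import Algebra.Bundles using (CommutativeMonoid)
open import Level using (0ℓ)
open import Data.Nat as ℕ using (ℕ; zero; suc; NonZero; _≥_; _>_; z≤n; s≤s)
import Data.Nat.Properties as ℕP
open import Data.Nat.DivMod using (m%n<n; m≡m%n+[m/n]*n; [m+n]%n≡m%n; [m+kn]%n≡m%n; n%n≡0; m<n⇒m%n≡m;
  m<n⇒m/n≡0; m*n/n≡m; m/n*n≤m; +-distrib-/-∣ʳ; /-monoˡ-≤)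
open import Data.Nat.Divisibility using (divides-refl)
open import Data.Nat.Logarithm using (⌊log₂_⌋; ⌊log₂⌋-mono-≤; ⌊log₂[2^n]⌋≡n)
import Data.Nat.Solver as ℕSolver
open import Data.Fin as Fin using (Fin; toℕ; fromℕ<)
import Data.Fin.Properties as FinP
open import Data.Vec as Vec using ([]; _∷_; lookup; replicate)
import Data.Vec.Properties as VecP
open import Data.List as List using (List; []; _∷_; _++_; allFin; concatMap; map; cartesianProductWith)
import Data.List.Properties as ListP
open import Data.List.Membership.Propositional using (_∈_; lose)
open import Data.List.Membership.Propositional.Properties using (∈-cartesianProductWith⁺; ∈-allFin)
open import Data.List.Relation.Unary.Any using (here; there)
open import Data.List.Relation.Unary.Any.Properties using (any⁺)
import Data.List.Relation.Unary.All as All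
open import Data.List.Relation.Unary.AllPairs using ([]; _∷_)
open import Data.List.Relation.Unary.Unique.Propositional using (Unique)
import Data.List.Relation.Unary.Unique.Propositional.Properties as UniqueP
open import Data.Bool using (Bool; true; false; if_then_else_)
import Data.Bool.Properties as BoolP
open import Data.Product using (Σ; _×_; ∃; _,_; proj₁; proj₂)
open import Data.Sum as Sum using (_⊎_; inj₁; inj₂; [_,_]′)
open import Data.Empty using (⊥-elim)
open import Function using (_∘_)
open import Function.Bundles using (Equivalence)
open import Relation.Nullary using (Dec; yes; no; ¬_; ⌊_⌋)
open import Relation.Nullary.Decidable using (_×-dec_; _⊎-dec_; fromWitness)
open import Relation.Binary.PropositionalEquality

-- Raising one site of a Lipschitz profile

-- The process is given as nested expectations along one list of all edges, in which the edges of
-- different blocks are interleaved, so no product measure is at hand to express independence. The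
-- bound therefore has to be an inequality on the current state that survives each single rounding;
-- the state records, for every block, whether it is still on script and how many prescribed
-- outcomes may remain. A block that has left the script may hold any loads, as may everything
-- outside the blocks, so only a box around each centre is controlled. It loses one site per step on
-- every side, and side 2T + 1 lasts for T steps, one for each token added. Slope 2 is the middle of
-- {1, 2, 3}, and 3 < 4d holds even for d = 1. A script of height W prescribes O(W^(2(d+1)))
-- outcomes, so W may be of order (log n)^(1/(2(d+1))), whence δ. The blocks are lined up along the
-- first coordinate only: these m / L blocks already exceed (4d)^E by any constant factor.

module Profile where
  open import Data.Nat
  open import Data.Nat.Properties

  δ : ℕ → ℕ → ℕ
  δ zero    zero    = 1
  δ zero    (suc i) = 0
  δ (suc s) zero    = 0
  δ (suc s) (suc i) = δ s i

  below : ℕ → ℕ → ℕ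
  below zero    _       = 0
  below (suc s) zero    = 1
  below (suc s) (suc i) = below s i

  below-suc : ∀ s i → below s i ≡ below s (suc i) + δ s (suc i)
  below-suc zero          i       = refl
  below-suc (suc zero)    zero    = refl
  below-suc (suc (suc s)) zero    = refl
  below-suc (suc s)       (suc i) = below-suc s i

  below-01 : ∀ s i → below s i ≡ 0 ⊎ below s i ≡ 1
  below-01 zero    i       = inj₁ refl
  below-01 (suc s) zero    = inj₂ refl
  below-01 (suc s) (suc i) = below-01 s i

  δ-refl : ∀ s → δ s s ≡ 1
  δ-refl zero    = refl
  δ-refl (suc s) = δ-refl s

  δ-≢ : ∀ s i → i ≢ s → δ s i ≡ 0
  δ-≢ zero    zero    ne = ⊥-elim (ne refl)
  δ-≢ zero    (suc i) ne = refl
  δ-≢ (suc s) zero    ne = refl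
  δ-≢ (suc s) (suc i) ne = δ-≢ s i (λ e → ne (cong suc e))

  bump : ℕ → (ℕ → ℕ) → ℕ → ℕ
  bump s b i = b i + δ s i

  bump-at : ∀ s b → bump s b s ≡ suc (b s)
  bump-at s b = trans (cong (b s +_) (δ-refl s)) (+-comm (b s) 1)

  bump-off : ∀ s b i → i ≢ s → bump s b i ≡ b i
  bump-off s b i ne = trans (cong (b i +_) (δ-≢ s i ne)) (+-identityʳ (b i))

  Lip : (ℕ → ℕ) → Set
  Lip b = ∀ i → (b i ≤ suc (b (suc i))) × (b (suc i) ≤ suc (b i))

  -- A site may be raised exactly when no neighbour is lower. The left neighbour is given by
  -- `suc j ≡ s`, which is vacuous at the end `s = 0`.
  bump-Lip : ∀ s b → Lip b → b s ≤ b (suc s) → (∀ j → suc j ≡ s → b s ≤ b j) → Lip (bump s b)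
  bump-Lip s b lip r l i with i ≟ s | suc i ≟ s
  ... | yes refl | yes e = ⊥-elim (1+n≢n e)
  ... | yes refl | no ne
    rewrite bump-at i b | bump-off i b (suc i) ne = s≤s r , m≤n⇒m≤1+n (proj₂ (lip i))
  ... | no ne | yes refl
    rewrite bump-at (suc i) b | bump-off (suc i) b i ne = m≤n⇒m≤1+n (proj₁ (lip i)) , s≤s (l i refl)
  ... | no ne | no ne'
    rewrite bump-off s b i ne | bump-off s b (suc i) ne' = lip i

  -- Path c W b n: from the profile b, at most n additions of single tokens raise site c to height W.
  data Path (c W : ℕ) : (ℕ → ℕ) → ℕ → Set where
    done : ∀ {b n} → W ≤ b c → Path c W b n
    step : ∀ {b n} s → Lip b → Path c W (bump s b) n → Path c W b (suc n)

  Path-mono : ∀ {c W b n n′} → n ≤ n′ → Path c W b n → Path c W b n′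
  Path-mono le (done w) = done w
  Path-mono (s≤s le) (step s lip p) = step s lip (Path-mono le p)

  module _ {c W : ℕ} where

    -- A left neighbour that blocks `s` has height exactly one less, by `Lip`; it is raised first,
    -- recursively, and then equals `s`. Heights drop along the chain, so at most one token per
    -- level 0, ..., h is added. A `Path` grows from its starting profile, hence the continuation;
    -- its last premise keeps the comparison with the right neighbour valid.
    raiseˡ : ∀ h s b n → Lip b → b s ≡ h → b s ≤ b (suc s) →
             (∀ b′ → Lip b′ → b′ s ≡ suc h → (∀ i → s < i → b′ i ≡ b i) → Path c W b′ n) →
             Path c W b (suc h + n)
    raiseˡ h zero b n lip eq r k =
      Path-mono (s≤s (m≤n+m n h)) (step 0 lip
        (k (bump 0 b) (bump-Lip 0 b lip r (λ _ ())) (trans (bump-at 0 b) (cong suc eq))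
           (λ i lt → bump-off 0 b i (>⇒≢ lt))))
    raiseˡ h (suc s) b n lip eq r k with b (suc s) ≤? b s
    ... | yes le =
      Path-mono (s≤s (m≤n+m n h)) (step (suc s) lip
        (k (bump (suc s) b) (bump-Lip (suc s) b lip r (λ { j refl → le }))
           (trans (bump-at (suc s) b) (cong suc eq))
           (λ i lt → bump-off (suc s) b i (>⇒≢ lt))))
    raiseˡ zero (suc s) b n lip eq r k | no nle = ⊥-elim (nle (subst (_≤ b s) (sym eq) z≤n))
    raiseˡ (suc h) (suc s) b n lip eq r k | no nle =
      subst (Path c W b) (trans (+-suc (suc h) n) refl)
        (raiseˡ h s b (suc n) lip bs (<⇒≤ lt) (λ b′ lip′ e′ same →
          let es : b′ (suc s) ≡ suc h
              es = trans (same (suc s) ≤-refl) eq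
              ess : b′ (suc (suc s)) ≡ b (suc (suc s))
              ess = same (suc (suc s)) (m≤n⇒m≤1+n ≤-refl)
              r′ : b′ (suc s) ≤ b′ (suc (suc s))
              r′ = subst₂ _≤_ (sym (same (suc s) ≤-refl)) (sym ess) r
          in step (suc s) lip′
               (k (bump (suc s) b′)
                  (bump-Lip (suc s) b′ lip′ r′ (λ { j refl → ≤-reflexive (trans es (sym e′)) }))
                  (trans (bump-at (suc s) b′) (cong suc es))
                  (λ i lt → trans (bump-off (suc s) b′ i (>⇒≢ lt)) (same i (<⇒≤ lt))))))
      where
      lt : b s < b (suc s)
      lt = ≰⇒> nle
      bs : b s ≡ h
      bs = suc-injective (≤-antisym (subst (b s <_) eq lt) (subst (_≤ suc (b s)) eq (proj₂ (lip s))))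

    -- Mirror image of `raiseˡ`. There is no end on this side, so the recursion stops only because a
    -- site of height 0 has no lower neighbour.
    raiseʳ : ∀ h s b n → Lip b → b s ≡ h → (∀ j → suc j ≡ s → b s ≤ b j) →
             (∀ b′ → Lip b′ → b′ s ≡ suc h → (∀ i → i < s → b′ i ≡ b i) → Path c W b′ n) →
             Path c W b (suc h + n)
    raiseʳ h s b n lip eq l k with b s ≤? b (suc s)
    ... | yes le =
      Path-mono (s≤s (m≤n+m n h)) (step s lip
        (k (bump s b) (bump-Lip s b lip le l)
           (trans (bump-at s b) (cong suc eq))
           (λ i lt → bump-off s b i (<⇒≢ lt))))
    raiseʳ zero s b n lip eq l k | no nle = ⊥-elim (nle (subst (_≤ b (suc s)) (sym eq) z≤n))
    raiseʳ (suc h) s b n lip eq l k | no nle =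
      subst (Path c W b) (+-suc (suc h) n)
        (raiseʳ h (suc s) b (suc n) lip bs (λ { j refl → <⇒≤ lt }) (λ b′ lip′ e′ same →
          let es : b′ s ≡ suc h
              es = trans (same s ≤-refl) eq
          in step s lip′
               (k (bump s b′)
                  (bump-Lip s b′ lip′ (≤-reflexive (trans es (sym e′)))
                    (λ { j refl → subst₂ _≤_ (sym (same s ≤-refl)) (sym (same j (m≤n⇒m≤1+n ≤-refl))) (l j refl) }))
                  (trans (bump-at s b′) (cong suc es))
                  (λ i lt → trans (bump-off s b′ i (<⇒≢ lt)) (same i (m≤n⇒m≤1+n lt))))))
      where
      lt : b (suc s) < b s
      lt = ≰⇒> nle
      bs : b (suc s) ≡ h
      bs = suc-injective (≤-antisym (subst (b (suc s) <_) eq lt) (subst (_≤ suc (b (suc s))) eq (proj₁ (lip s))))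

    -- A lower right neighbour is lifted first, in h tokens; then the left chain and `s` itself take
    -- at most h + 1. The right chain leaves `s` unchanged.
    raise : ∀ h s b n → Lip b → b s ≡ h →
            (∀ b′ → Lip b′ → b′ s ≡ suc h → Path c W b′ n) →
            Path c W b (suc h + (h + n))
    raise h s b n lip eq k with b s ≤? b (suc s)
    ... | yes le = Path-mono (+-monoʳ-≤ (suc h) (m≤n+m n h))
                     (raiseˡ h s b n lip eq le (λ b′ lip′ e _ → k b′ lip′ e))
    raise zero s b n lip eq k | no nle = ⊥-elim (nle (subst (_≤ b (suc s)) (sym eq) z≤n))
    raise (suc h) s b n lip eq k | no nle =
      subst (Path c W b) lemma
        (raiseʳ h (suc s) b (suc (suc h) + n) lip bs (λ { j refl → <⇒≤ lt }) (λ b′ lip′ e′ same →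
          let es : b′ s ≡ suc h
              es = trans (same s ≤-refl) eq
          in raiseˡ (suc h) s b′ n lip′ es (≤-reflexive (trans es (sym e′)))
               (λ b″ lip″ e″ _ → k b″ lip″ e″)))
      where
      lt : b (suc s) < b s
      lt = ≰⇒> nle
      bs : b (suc s) ≡ h
      bs = suc-injective (≤-antisym (subst (b (suc s) <_) eq lt) (subst (_≤ suc (b (suc s))) eq (proj₁ (lip s))))
      lemma : suc h + (suc (suc h) + n) ≡ suc (suc h) + (suc h + n)
      lemma = trans (sym (+-assoc (suc h) (suc (suc h)) n))
                (trans (cong (_+ n) (+-comm (suc h) (suc (suc h)))) (+-assoc (suc (suc h)) (suc h) n))

    -- Of the `k` levels still missing, each costs at most 2h + 1 tokens with h < W, hence at most
    -- 2W.
    climb : ∀ k h b → Lip b → b c ≡ h → h + k ≡ W → Path c W b (k * (W + W))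
    climb zero    h b lip eq e = done (≤-reflexive (trans (sym e) (trans (+-identityʳ h) (sym eq))))
    climb (suc k) h b lip eq e =
      Path-mono (≤-trans (≤-reflexive (sym (+-assoc (suc h) h _))) (+-monoˡ-≤ _ (+-mono-≤ hW (<⇒≤ hW))))
        (raise h c b (k * (W + W)) lip eq
          (λ b′ lip′ e′ → climb k (suc h) b′ lip′ e′ (trans (sym (+-suc h k)) e)))
      where
      hW : suc h ≤ W
      hW = subst (suc h ≤_) (trans (sym (+-suc h k)) e) (s≤s (m≤m+n h k))

  path : ∀ c W → Path c W (λ _ → 0) (W * (W + W))
  path c W = climb W 0 (λ _ → 0) (λ _ → z≤n , z≤n) refl refl

-- The height of the script as a function of the side of the torus

module Height where
  open import Data.Nat
  open import Data.Nat.Properties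

  m≤2^m : ∀ m → m ≤ 2 ^ m
  m≤2^m zero    = z≤n
  m≤2^m (suc m) = ≤-trans (s≤s (m≤2^m m)) (≤-trans (+-monoˡ-≤ (2 ^ m) (m^n>0 2 m)) (≤-reflexive (cong (2 ^ m +_) (sym (+-identityʳ (2 ^ m))))))

  ^-distribʳ-* : ∀ n a b → (a * b) ^ n ≡ a ^ n * b ^ n
  ^-distribʳ-* zero    a b = refl
  ^-distribʳ-* (suc n) a b = trans (cong (a * b *_) (^-distribʳ-* n a b))
    (solve 4 (λ a b x y → a :* b :* (x :* y) := a :* x :* (b :* y)) refl a b (a ^ n) (b ^ n))
    where open ℕSolver.+-*-Solver

  module Largest {P : ℕ → Set} (P? : ∀ k → Dec (P k)) where

    largest : ℕ → ℕ
    largest zero    = zero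
    largest (suc k) with P? (suc k)
    ... | yes _ = suc k
    ... | no _  = largest k

    largest-≥ : ∀ {i} k → P i → i ≤ k → i ≤ largest k
    largest-≥ zero    pi le = le
    largest-≥ (suc k) pi le with P? (suc k) | m≤n⇒m<n∨m≡n le
    ... | yes _ | _         = le
    ... | no _  | inj₁ lt   = largest-≥ k pi (≤-pred lt)
    ... | no np | inj₂ refl = ⊥-elim (np pi)

    largest-holds : ∀ {i} k → P i → i ≤ k → P (largest k)
    largest-holds {zero} zero    pi le = pi
    largest-holds        (suc k) pi le with P? (suc k) | m≤n⇒m<n∨m≡n le
    ... | yes p | _         = p
    ... | no _  | inj₁ lt   = largest-holds k pi (≤-pred lt)
    ... | no np | inj₂ refl = ⊥-elim (np pi)

    largest-max : ∀ {j} k → largest k < j → j ≤ k → ¬ P j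
    largest-max zero    lt le pj = <⇒≱ lt le
    largest-max (suc k) lt le pj with P? (suc k) | m≤n⇒m<n∨m≡n le
    ... | yes _ | _         = <⇒≱ lt le
    ... | no _  | inj₁ lt′  = largest-max k lt (≤-pred lt′) pj
    ... | no np | inj₂ refl = np pj

  module Scale (d′ : ℕ) where

    d = suc d′
    D = 4 * d

    time : ℕ → ℕ
    time w = w * (w + w)

    -- Radius `time w` around the centre: influence travels one site per step, so the boundary of
    -- the block cannot reach the centre while the script runs.
    side : ℕ → ℕ
    side w = suc (time w + time w)

    -- Number of steps times a bound on the edges of one block: an upper bound on the rounding
    -- outcomes that the script prescribes.
    budget : ℕ → ℕ
    budget w = time w * (d * side w ^ d)

    -- 2 ^ h w bounds side w * D ^ budget w, so a torus of side 2 ^ (2 h w) has many blocks of height w.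
    h : ℕ → ℕ
    h w = suc (D * d) * (5 * w ^ 2) ^ suc d

    private
      w²-pos : ∀ w → 1 ≤ w → 1 ≤ w ^ 2
      w²-pos (suc w) _ = m^n>0 (suc w) 2

      base-≤-power : ∀ x n → 1 ≤ x → x ≤ x ^ suc n
      base-≤-power x@(suc _) n _ = subst (_≤ x ^ suc n) (*-identityʳ x) (*-monoʳ-≤ x (m^n>0 x n))

    module _ (w : ℕ) (1≤w : 1 ≤ w) where

      private
        -- `side w` is 4w² + 1, which is at most 5w² once w ≥ 1.
        M = 5 * w ^ 2
        1≤M : 1 ≤ M
        1≤M = ≤-trans (w²-pos w 1≤w) (m≤m+n (w ^ 2) (4 * w ^ 2))

      time-≤ : time w ≤ M
      time-≤ = subst (_≤ M) (solve 1 (λ w → con 2 :* w :^ 2 := w :* (w :+ w)) refl w)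
                 (*-monoˡ-≤ (w ^ 2) {2} {5} (s≤s (s≤s z≤n)))
        where open ℕSolver.+-*-Solver

      side-≤ : side w ≤ M
      side-≤ = subst₂ _≤_ (cong suc (solve 1 (λ w → con 4 :* w :^ 2 := w :* (w :+ w) :+ w :* (w :+ w)) refl w)) refl
                 (+-monoˡ-≤ (4 * w ^ 2) (w²-pos w 1≤w))
        where open ℕSolver.+-*-Solver

      side+budget-≤ : side w + D * budget w ≤ h w
      side+budget-≤ = begin
        side w + D * (time w * (d * side w ^ d))  ≤⟨ +-mono-≤ (≤-trans side-≤ (base-≤-power M d 1≤M)) (*-monoʳ-≤ D (*-mono-≤ time-≤ (*-monoʳ-≤ d (^-monoˡ-≤ d side-≤)))) ⟩
        M ^ suc d + D * (M * (d * M ^ d))         ≡⟨ solve 4 (λ D d m p → m :* p :+ D :* (m :* (d :* p)) := (con 1 :+ D :* d) :* (m :* p)) refl D d M (M ^ d) ⟩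
        h w                                       ∎
        where open ≤-Reasoning
              open ℕSolver.+-*-Solver

      cost-≤ : D ^ budget w * side w ≤ 2 ^ h w
      cost-≤ = begin
        D ^ budget w * side w            ≤⟨ *-mono-≤ (^-monoˡ-≤ (budget w) (m≤2^m D)) (m≤2^m (side w)) ⟩
        (2 ^ D) ^ budget w * 2 ^ side w  ≡⟨ cong (_* 2 ^ side w) (^-*-assoc 2 D (budget w)) ⟩
        2 ^ (D * budget w) * 2 ^ side w  ≡⟨ sym (^-distribˡ-+-* 2 (D * budget w) (side w)) ⟩
        2 ^ (D * budget w + side w)      ≤⟨ ^-monoʳ-≤ 2 (≤-trans (≤-reflexive (+-comm (D * budget w) (side w))) side+budget-≤) ⟩
        2 ^ h w                          ∎
        where open ≤-Reasoning

      -- The side of the torus is bounded through the first height that fails, while the deviation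
      -- is the last one that works. Since w + 1 ≤ 2w, passing between them costs only a constant: 5
      -- · 2² = 20.
      h-suc : h (suc w) ≤ suc (D * d) * 20 ^ suc d * w ^ (2 * suc d)
      h-suc = begin
        suc (D * d) * (5 * suc w ^ 2) ^ suc d             ≤⟨ *-monoʳ-≤ (suc (D * d)) (^-monoˡ-≤ (suc d) (*-monoʳ-≤ 5 (^-monoˡ-≤ 2 (+-monoˡ-≤ w 1≤w)))) ⟩
        suc (D * d) * (5 * (w + w) ^ 2) ^ suc d           ≡⟨ cong (λ z → suc (D * d) * z ^ suc d) (solve 1 (λ w → con 5 :* (w :+ w) :^ 2 := con 20 :* w :^ 2) refl w) ⟩
        suc (D * d) * (20 * w ^ 2) ^ suc d                ≡⟨ cong (suc (D * d) *_) (^-distribʳ-* (suc d) 20 (w ^ 2)) ⟩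
        suc (D * d) * (20 ^ suc d * (w ^ 2) ^ suc d)      ≡⟨ sym (*-assoc (suc (D * d)) (20 ^ suc d) _) ⟩
        suc (D * d) * 20 ^ suc d * (w ^ 2) ^ suc d        ≡⟨ cong (suc (D * d) * 20 ^ suc d *_) (^-*-assoc w 2 (suc d)) ⟩
        suc (D * d) * 20 ^ suc d * w ^ (2 * suc d)        ∎
        where open ≤-Reasoning
              open ℕSolver.+-*-Solver

    w≤h : ∀ w → w ≤ h w
    w≤h zero        = z≤n
    w≤h w@(suc n) = begin
      w                        ≤⟨ m≤m+n w w ⟩
      w + w                    ≤⟨ m≤m+n (w + w) (n * (w + w)) ⟩
      time w                   ≤⟨ m≤n⇒m≤1+n (m≤m+n (time w) (time w)) ⟩
      side w                   ≤⟨ m≤m+n (side w) (D * budget w) ⟩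
      side w + D * budget w    ≤⟨ side+budget-≤ w (s≤s z≤n) ⟩
      h w                      ∎
      where open ≤-Reasoning

    module Heights (m : ℕ) = Largest {λ w → 2 ^ (2 * h w) ≤ m} (λ w → 2 ^ (2 * h w) ≤? m)

    height : ℕ → ℕ
    height m = Heights.largest m m

    -- Every admissible height is thus at most m, so the search up to m in `height` is exhaustive.
    w≤2^2h : ∀ w → w ≤ 2 ^ (2 * h w)
    w≤2^2h w = ≤-trans (w≤h w) (≤-trans (m≤m+n (h w) _) (m≤2^m (2 * h w)))

    module _ {I m : ℕ} (large : 2 ^ (2 * h I) ≤ m) where

      private
        I≤m : I ≤ m
        I≤m = ≤-trans (w≤2^2h I) large

      height-≥ : I ≤ height m
      height-≥ = Heights.largest-≥ m {I} m large I≤m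

      height-holds : 2 ^ (2 * h (height m)) ≤ m
      height-holds = Heights.largest-holds m {I} m large I≤m

      height-max : m ≤ 2 ^ (2 * h (suc (height m)))
      height-max = [ (λ le → ≰⇒≥ (Heights.largest-max m {suc (height m)} m ≤-refl le))
                   , (λ lt → ≤-trans (<⇒≤ lt) (w≤2^2h (suc (height m)))) ]′ (≤-<-connex (suc (height m)) m)

      -- This is the reason for the factor 2 in the exponent: one factor `2 ^ h w` pays for
      -- `D ^ budget w * side w`, the other for the surplus `I`, since I ≤ w ≤ h w.
      many-blocks : 1 ≤ I → I * D ^ budget (height m) ≤ m / side (height m)
      many-blocks 1≤I = subst (_≤ m / side w) (m*n/n≡m (I * D ^ budget w) (side w)) (/-monoˡ-≤ (side w) (begin
        I * D ^ budget w * side w       ≡⟨ *-assoc I (D ^ budget w) (side w) ⟩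
        I * (D ^ budget w * side w)     ≤⟨ *-mono-≤ (≤-trans height-≥ (≤-trans (w≤h w) (m≤2^m (h w)))) (cost-≤ w (≤-trans 1≤I height-≥)) ⟩
        2 ^ h w * 2 ^ h w               ≡⟨ sym (^-distribˡ-+-* 2 (h w) (h w)) ⟩
        2 ^ (h w + h w)                 ≡⟨ cong (λ z → 2 ^ (h w + z)) (sym (+-identityʳ (h w))) ⟩
        2 ^ (2 * h w)                   ≤⟨ height-holds ⟩
        m                               ∎))
        where open ≤-Reasoning
              w = height m

      -- Maximality of the height bounds m by a power of 2 whose exponent is polynomial in the
      -- height. The degree 2(d + 1) is the reciprocal of δ, and the constant becomes 1/K.
      log-≤ : 1 ≤ I → ⌊log₂ (m ^ d) ⌋ ≤ 2 * (suc (D * d) * 20 ^ suc d) * d * height m ^ (2 * suc d)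
      log-≤ 1≤I = begin
        ⌊log₂ (m ^ d) ⌋                                     ≤⟨ ⌊log₂⌋-mono-≤ (^-monoˡ-≤ d height-max) ⟩
        ⌊log₂ ((2 ^ (2 * h (suc w))) ^ d) ⌋                 ≡⟨ cong ⌊log₂_⌋ (^-*-assoc 2 (2 * h (suc w)) d) ⟩
        ⌊log₂ (2 ^ (2 * h (suc w) * d)) ⌋                   ≡⟨ ⌊log₂[2^n]⌋≡n (2 * h (suc w) * d) ⟩
        2 * h (suc w) * d                                   ≤⟨ *-monoˡ-≤ d (*-monoʳ-≤ 2 (h-suc w (≤-trans 1≤I height-≥))) ⟩
        2 * (c * w ^ (2 * suc d)) * d                       ≡⟨ solve 3 (λ c x d → con 2 :* (c :* x) :* d := con 2 :* c :* d :* x) refl c (w ^ (2 * suc d)) d ⟩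
        2 * c * d * w ^ (2 * suc d)                         ∎
        where open ≤-Reasoning
              open ℕSolver.+-*-Solver
              w = height m
              c = suc (D * d) * 20 ^ suc d

open Profile
open Height
open import Data.Integer as ℤ using (ℤ; +_)
import Data.Integer.Properties as ℤP
open import Data.Rational as ℚ using (ℚ; mkℚ; _≤_; _<_; _+_; _*_; _-_; -_; _/_; 0ℚ; 1ℚ; fromℚᵘ; toℚᵘ; positive)
open import Data.Rational.Properties
import Data.Rational.Unnormalised as ℚᵘ
import Data.Rational.Unnormalised.Properties as ℚᵘP
open import Data.Rational.Solver using (module +-*-Solver)

-- Rational arithmetic and the failure probability of independent blocks

fromℚᵘ-+ : ∀ p q → fromℚᵘ p + fromℚᵘ q ≡ fromℚᵘ (p ℚᵘ.+ q)
fromℚᵘ-+ p q = toℚᵘ-injective (ℚᵘP.≃-trans (toℚᵘ-homo-+ (fromℚᵘ p) (fromℚᵘ q))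
  (ℚᵘP.≃-trans (ℚᵘP.+-cong (toℚᵘ-fromℚᵘ p) (toℚᵘ-fromℚᵘ q)) (ℚᵘP.≃-sym (toℚᵘ-fromℚᵘ (p ℚᵘ.+ q)))))

fromℚᵘ-* : ∀ p q → fromℚᵘ p * fromℚᵘ q ≡ fromℚᵘ (p ℚᵘ.* q)
fromℚᵘ-* p q = toℚᵘ-injective (ℚᵘP.≃-trans (toℚᵘ-homo-* (fromℚᵘ p) (fromℚᵘ q))
  (ℚᵘP.≃-trans (ℚᵘP.*-cong (toℚᵘ-fromℚᵘ p) (toℚᵘ-fromℚᵘ q)) (ℚᵘP.≃-sym (toℚᵘ-fromℚᵘ (p ℚᵘ.* q)))))

cross-≡ : ∀ i a j b → i ℤ.* + suc b ≡ j ℤ.* + suc a → i / suc a ≡ j / suc b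
cross-≡ i a j b e = fromℚᵘ-cong {ℚᵘ.mkℚᵘ i a} {ℚᵘ.mkℚᵘ j b} (ℚᵘ.*≡* e)

cross-≤ : ∀ i a j b → i ℤ.* + suc b ℤ.≤ j ℤ.* + suc a → i / suc a ≤ j / suc b
cross-≤ i a j b le = toℚᵘ-cancel-≤
  (ℚᵘP.≤-trans (ℚᵘP.≤-reflexive (toℚᵘ-fromℚᵘ p)) (ℚᵘP.≤-trans (ℚᵘ.*≤* le) (ℚᵘP.≤-reflexive (ℚᵘP.≃-sym (toℚᵘ-fromℚᵘ q)))))
  where
  p = ℚᵘ.mkℚᵘ i a
  q = ℚᵘ.mkℚᵘ j b

ℤtoℚ-+ : ∀ i j → ℤtoℚ (i ℤ.+ j) ≡ ℤtoℚ i + ℤtoℚ j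
ℤtoℚ-+ i j = sym (trans (fromℚᵘ-+ (ℚᵘ.mkℚᵘ i 0) (ℚᵘ.mkℚᵘ j 0))
  (cross-≡ (i ℤ.* + 1 ℤ.+ j ℤ.* + 1) 0 (i ℤ.+ j) 0 (cong (ℤ._* + 1) (cong₂ ℤ._+_ (ℤP.*-identityʳ i) (ℤP.*-identityʳ j)))))

ι : ℕ → ℚ
ι n = ℤtoℚ (+ n)

ι-+ : ∀ a b → ι (a ℕ.+ b) ≡ ι a + ι b
ι-+ a b = ℤtoℚ-+ (+ a) (+ b)

ι-* : ∀ a b → ι (a ℕ.* b) ≡ ι a * ι b
ι-* a b = sym (trans (fromℚᵘ-* (ℚᵘ.mkℚᵘ (+ a) 0) (ℚᵘ.mkℚᵘ (+ b) 0))
  (cross-≡ (+ a ℤ.* + b) 0 (+ (a ℕ.* b)) 0 (cong (ℤ._* + 1) (sym (ℤP.pos-* a b)))))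

ι-mono : ∀ {a b} → a ℕ.≤ b → ι a ≤ ι b
ι-mono {a} {b} le = cross-≤ (+ a) 0 (+ b) 0 (ℤP.*-monoʳ-≤-nonNeg (+ 1) (ℤ.+≤+ le))

0≤ι : ∀ n → 0ℚ ≤ ι n
0≤ι n = ι-mono {0} {n} ℕ.z≤n

ι-pow : ∀ a q → powℚ (ι a) q ≡ ι (a ℕ.^ q)
ι-pow a zero    = refl
ι-pow a (suc q) = trans (cong (ι a *_) (ι-pow a q)) (sym (ι-* a (a ℕ.^ q)))

module _ (D : ℕ) .{{nz : ℕ.NonZero D}} where

  frac-mono : ∀ {a b} → a ℕ.≤ b → + a / D ≤ + b / D
  frac-mono le = fmono D le
    where
    fmono : ∀ D .{{_ : ℕ.NonZero D}} {a b} → a ℕ.≤ b → + a / D ≤ + b / D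
    fmono (suc D) {a} {b} le = cross-≤ (+ a) D (+ b) D (ℤP.*-monoʳ-≤-nonNeg (+ suc D) (ℤ.+≤+ le))

  frac-+ : ∀ a b → + a / D + + b / D ≡ + (a ℕ.+ b) / D
  frac-+ a b = f D a b
    where
    open ≡-Reasoning
    f : ∀ D .{{_ : ℕ.NonZero D}} a b → + a / D + + b / D ≡ + (a ℕ.+ b) / D
    f (suc D) a b = trans (fromℚᵘ-+ (ℚᵘ.mkℚᵘ (+ a) D) (ℚᵘ.mkℚᵘ (+ b) D))
      (cross-≡ (+ a ℤ.* s ℤ.+ + b ℤ.* s) (D ℕ.+ D ℕ.* suc D) (+ (a ℕ.+ b)) D
        (trans (cong (ℤ._* s) (sym (ℤP.*-distribʳ-+ s (+ a) (+ b)))) (ℤP.*-assoc (+ a ℤ.+ + b) s s)))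
      where s = + suc D

  frac-self : + D / D ≡ 1ℚ
  frac-self = f D
    where
    f : ∀ D .{{_ : ℕ.NonZero D}} → + D / D ≡ 1ℚ
    f (suc D) = cross-≡ (+ suc D) D (+ 1) 0 (ℤP.*-comm (+ suc D) (+ 1))

  frac-*ι : ∀ a n → + a / D * ι n ≡ + (a ℕ.* n) / D
  frac-*ι a n = f D
    where
    f : ∀ D .{{_ : ℕ.NonZero D}} → + a / D * ι n ≡ + (a ℕ.* n) / D
    f (suc D) = trans (fromℚᵘ-* (ℚᵘ.mkℚᵘ (+ a) D) (ℚᵘ.mkℚᵘ (+ n) 0))
      (cross-≡ (+ a ℤ.* + n) (D ℕ.* 1) (+ (a ℕ.* n)) D (cong₂ ℤ._*_ (sym (ℤP.pos-* a n)) (cong +_ (sym (ℕP.*-identityʳ (suc D))))))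

  1/-*ι : + 1 / D * ι D ≡ 1ℚ
  1/-*ι = trans (frac-*ι 1 D) (trans (cong (λ z → + z / D) (ℕP.*-identityˡ D)) frac-self)

  0≤frac : ∀ a → 0ℚ ≤ + a / D
  0≤frac a = subst (_≤ + a / D) (0/n≡0 D) (frac-mono {0} {a} ℕ.z≤n)

  1-frac : ∀ {a b} → a ℕ.+ b ≡ D → 1ℚ - + a / D ≡ + b / D
  1-frac {a} {b} e = begin
    1ℚ - + a / D                    ≡⟨ cong (_- + a / D) (sym frac-self) ⟩
    + D / D - + a / D               ≡⟨ cong (λ n → + n / D - + a / D) (sym e) ⟩
    + (a ℕ.+ b) / D - + a / D       ≡⟨ cong (_- + a / D) (sym (frac-+ a b)) ⟩
    (+ a / D + + b / D) - + a / D   ≡⟨ solve 2 (λ x y → (x :+ y) :- x := y) refl (+ a / D) (+ b / D) ⟩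
    + b / D                         ∎
    where open ≡-Reasoning
          open +-*-Solver

0≤1 : 0ℚ ≤ 1ℚ
0≤1 = ι-mono {0} {1} ℕ.z≤n

*-mono-ʳ : ∀ {r p q} → 0ℚ ≤ r → p ≤ q → r * p ≤ r * q
*-mono-ʳ {r} h = *-monoˡ-≤-nonNeg r {{ℚ.nonNegative h}}

*-mono-ˡ : ∀ {r p q} → 0ℚ ≤ r → p ≤ q → p * r ≤ q * r
*-mono-ˡ {r} h = *-monoʳ-≤-nonNeg r {{ℚ.nonNegative h}}

0≤* : ∀ {p q} → 0ℚ ≤ p → 0ℚ ≤ q → 0ℚ ≤ p * q
0≤* {p} {q} hp hq = subst (_≤ p * q) (*-zeroʳ p) (*-mono-ʳ hp hq)

≤⇒0≤- : ∀ {p q} → p ≤ q → 0ℚ ≤ q - p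
≤⇒0≤- {p} {q} le = subst (_≤ q - p) (+-inverseʳ p) (+-monoˡ-≤ (- p) le)

0≤-⇒≤ : ∀ {p q} → 0ℚ ≤ q - p → p ≤ q
0≤-⇒≤ {p} {q} le = subst₂ _≤_ (+-identityˡ p) (solve 2 (λ p q → q :- p :+ p := q) refl p q) (+-monoˡ-≤ p le)
  where open +-*-Solver

1-anti : ∀ {p q} → p ≤ q → 1ℚ - q ≤ 1ℚ - p
1-anti le = +-monoʳ-≤ 1ℚ (neg-antimono-≤ le)

1-≤1 : ∀ {p} → 0ℚ ≤ p → 1ℚ - p ≤ 1ℚ
1-≤1 le = 1-anti le

mix-≤ : ∀ {p q B X Y} → 0ℚ ≤ p → 0ℚ ≤ q → p + q ≡ 1ℚ → B ≤ X → B ≤ Y → B ≤ p * X + q * Y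
mix-≤ {p} {q} {B} {X} {Y} hp hq pq bx by =
  subst (_≤ p * X + q * Y) (trans (sym (*-distribʳ-+ B p q)) (trans (cong (_* B) pq) (*-identityˡ B)))
    (+-mono-≤ (*-mono-ʳ hp bx) (*-mono-ʳ hq by))

-- The product of the 1 - g k: the chance that N independent trials with success probabilities g all
-- fail.
failProb : ℕ → (ℕ → ℚ) → ℚ
failProb zero    g = 1ℚ
failProb (suc N) g = (1ℚ - g N) * failProb N g

module _ {g : ℕ → ℚ} where

  failProb-nonneg : ∀ N → (∀ k → g k ≤ 1ℚ) → 0ℚ ≤ failProb N g
  failProb-nonneg zero    h = 0≤1
  failProb-nonneg (suc N) h = 0≤* (≤⇒0≤- (h N)) (failProb-nonneg N h)

  failProb-none : ∀ N → (∀ k → k ℕ.< N → g k ≡ 0ℚ) → failProb N g ≡ 1ℚ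
  failProb-none zero    h = refl
  failProb-none (suc N) h rewrite h N ℕP.≤-refl | failProb-none N (λ k lt → h k (ℕP.m≤n⇒m≤1+n lt)) = refl

  failProb-anti : ∀ {g′} N → (∀ k → g k ≤ g′ k) → (∀ k → g′ k ≤ 1ℚ) → failProb N g′ ≤ failProb N g
  failProb-anti zero    le h = ≤-refl
  failProb-anti {g′} (suc N) le h = ≤-trans
    (*-mono-ʳ (≤⇒0≤- (h N)) (failProb-anti N le h))
    (*-mono-ˡ (failProb-nonneg N (λ k → ≤-trans (le k) (h k))) (1-anti (le N)))

failProb-cong : ∀ {g g′} N → (∀ k → k ℕ.< N → g k ≡ g′ k) → failProb N g ≡ failProb N g′
failProb-cong zero    h = refl
failProb-cong (suc N) h =
  cong₂ _*_ (cong (λ z → 1ℚ - z) (h N ℕP.≤-refl)) (failProb-cong N (λ k lt → h k (ℕP.m≤n⇒m≤1+n lt)))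

-- The product is affine in each factor, so if only factor `k` varies, an averaging inequality for
-- that factor passes to the whole product.
failProb-mix : ∀ {p q g g₁ g₂} k N → k ℕ.< N → (∀ j → g j ≤ 1ℚ) →
  (∀ j → j ≢ k → g₁ j ≡ g j) → (∀ j → j ≢ k → g₂ j ≡ g j) →
  p * (1ℚ - g₁ k) + q * (1ℚ - g₂ k) ≤ 1ℚ - g k →
  p * failProb N g₁ + q * failProb N g₂ ≤ failProb N g
failProb-mix {p} {q} {g} {g₁} {g₂} k (suc N) k<N h e₁ e₂ le with N ℕP.≟ k
... | yes refl = subst (_≤ failProb (suc N) g) (sym rearr) (*-mono-ˡ (failProb-nonneg N h) le)
  where
  open +-*-Solver
  off : ∀ g′ → (∀ j → j ≢ N → g′ j ≡ g j) → failProb N g′ ≡ failProb N g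
  off g′ e = failProb-cong N (λ j lt → e j (ℕP.<⇒≢ lt))
  rearr : p * failProb (suc N) g₁ + q * failProb (suc N) g₂ ≡
          (p * (1ℚ - g₁ N) + q * (1ℚ - g₂ N)) * failProb N g
  rearr rewrite off g₁ e₁ | off g₂ e₂ =
    solve 5 (λ p q a b f → p :* (a :* f) :+ q :* (b :* f) := (p :* a :+ q :* b) :* f) refl
      p q (1ℚ - g₁ N) (1ℚ - g₂ N) (failProb N g)
... | no ne = subst (_≤ failProb (suc N) g) (sym rearr)
    (*-mono-ʳ (≤⇒0≤- (h N)) (failProb-mix {p} {q} k N k<N′ h e₁ e₂ le))
  where
  open +-*-Solver
  k<N′ : k ℕ.< N
  k<N′ = ℕP.≤∧≢⇒< (ℕP.≤-pred k<N) (λ e → ne (sym e))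
  rearr : p * failProb (suc N) g₁ + q * failProb (suc N) g₂ ≡
          (1ℚ - g N) * (p * failProb N g₁ + q * failProb N g₂)
  rearr rewrite e₁ N ne | e₂ N ne =
    solve 5 (λ p q a b c → p :* (a :* b) :+ q :* (a :* c) := a :* (p :* b :+ q :* c)) refl
      p q (1ℚ - g N) (failProb N g₁) (failProb N g₂)

module _ {c : ℚ} (0≤c : 0ℚ ≤ c) (c≤1 : c ≤ 1ℚ) where

  powℚ-nonneg : ∀ e → 0ℚ ≤ powℚ c e
  powℚ-nonneg zero    = 0≤1
  powℚ-nonneg (suc e) = 0≤* 0≤c (powℚ-nonneg e)

  powℚ-step : ∀ e → powℚ c (suc e) ≤ powℚ c e
  powℚ-step e = subst (c * powℚ c e ≤_) (*-identityˡ _) (*-mono-ˡ (powℚ-nonneg e) c≤1)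

  powℚ-anti : ∀ {e e′} → e ℕ.≤ e′ → powℚ c e′ ≤ powℚ c e
  powℚ-anti {e} {e′} le with ℕP.m≤n⇒m<n∨m≡n le
  ... | inj₂ refl = ≤-refl
  powℚ-anti {e} {suc e′} le | inj₁ lt = ≤-trans (powℚ-step e′) (powℚ-anti (ℕP.≤-pred lt))

  powℚ-≤1 : ∀ e → powℚ c e ≤ 1ℚ
  powℚ-≤1 e = powℚ-anti {0} {e} ℕ.z≤n

powℚ-unit : ∀ {c D} e → c * ι D ≡ 1ℚ → powℚ c e * ι (D ℕ.^ e) ≡ 1ℚ
powℚ-unit zero h = refl
powℚ-unit {c} {D} (suc e) h = begin
  c * powℚ c e * ι (D ℕ.* D ℕ.^ e)      ≡⟨ cong (c * powℚ c e *_) (ι-* D (D ℕ.^ e)) ⟩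
  c * powℚ c e * (ι D * ι (D ℕ.^ e))    ≡⟨ solve 4 (λ a b c d → a :* b :* (c :* d) := (a :* c) :* (b :* d)) refl c (powℚ c e) (ι D) (ι (D ℕ.^ e)) ⟩
  (c * ι D) * (powℚ c e * ι (D ℕ.^ e))  ≡⟨ cong₂ _*_ h (powℚ-unit {c} {D} e h) ⟩
  1ℚ                                    ∎
  where open ≡-Reasoning
        open +-*-Solver

-- (1 - x)ᴺ (1 + N x) ≤ 1, because (1 - x) (1 + (N + 1) x) = 1 + N x - (N + 1) x².
bernoulli : ∀ {x} N → 0ℚ ≤ x → x ≤ 1ℚ → failProb N (λ _ → x) * (1ℚ + ι N * x) ≤ 1ℚ
bernoulli {x} zero h h′ = ≤-reflexive (trans (*-identityˡ _) (trans (cong (λ z → 1ℚ + z) (*-zeroˡ x)) (+-identityʳ 1ℚ)))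
bernoulli {x} (suc N) h h′ = ≤-trans
  (subst₂ _≤_ (solve 3 (λ a b f → f :* (a :* b) := (a :* f) :* b) refl (1ℚ - x) (1ℚ + ι (suc N) * x) F) refl
    (*-mono-ʳ (failProb-nonneg N (λ _ → h′)) key))
  (bernoulli N h h′)
  where
  open +-*-Solver
  F = failProb N (λ _ → x)
  n = ι N
  nonneg : 0ℚ ≤ (n + 1ℚ) * (x * x)
  nonneg = 0≤* (subst (0ℚ ≤_) (trans (cong ι (ℕP.+-comm 1 N)) (ι-+ N 1)) (0≤ι (suc N))) (0≤* h h)
  eq : (1ℚ + n * x) - (1ℚ - x) * (1ℚ + (n + 1ℚ) * x) ≡ (n + 1ℚ) * (x * x)
  eq = solve 2 (λ n x → (con 1ℚ :+ n :* x) :- (con 1ℚ :- x) :* (con 1ℚ :+ (n :+ con 1ℚ) :* x)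
                        := (n :+ con 1ℚ) :* (x :* x)) refl n x
  key : (1ℚ - x) * (1ℚ + ι (suc N) * x) ≤ 1ℚ + n * x
  key = subst (λ z → (1ℚ - x) * (1ℚ + z * x) ≤ 1ℚ + n * x)
          (sym (trans (cong ι (ℕP.+-comm 1 N)) (ι-+ N 1)))
          (0≤-⇒≤ (subst (0ℚ ≤_) (sym eq) nonneg))

-- The torus

module ListSum (M : CommutativeMonoid 0ℓ 0ℓ) where
  open CommutativeMonoid M renaming (refl to ≈-refl; sym to ≈-sym; trans to ≈-trans)
  open import Algebra.Properties.CommutativeSemigroup commutativeSemigroup using (interchange)

  ∑ : {A : Set} → (A → Carrier) → List A → Carrier
  ∑ f []       = ε
  ∑ f (x ∷ xs) = f x ∙ ∑ f xs

  module _ {A : Set} where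

    ∑-cong : {f g : A → Carrier} → (∀ x → f x ≈ g x) → ∀ xs → ∑ f xs ≈ ∑ g xs
    ∑-cong e []       = ≈-refl
    ∑-cong e (x ∷ xs) = ∙-cong (e x) (∑-cong e xs)

    ∑-++ : (f : A → Carrier) → ∀ xs ys → ∑ f (xs ++ ys) ≈ ∑ f xs ∙ ∑ f ys
    ∑-++ f []       ys = ≈-sym (identityˡ _)
    ∑-++ f (x ∷ xs) ys = ≈-trans (∙-congˡ (∑-++ f xs ys)) (≈-sym (assoc _ _ _))

    ∑-ε : (f : A → Carrier) → ∀ xs → (∀ x → x ∈ xs → f x ≈ ε) → ∑ f xs ≈ ε
    ∑-ε f []       h = ≈-refl
    ∑-ε f (x ∷ xs) h = ≈-trans (∙-cong (h x (here refl)) (∑-ε f xs (λ y m → h y (there m)))) (identityˡ ε)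

    ∑-∙ : (f g : A → Carrier) → ∀ xs → ∑ (λ x → f x ∙ g x) xs ≈ ∑ f xs ∙ ∑ g xs
    ∑-∙ f g []       = ≈-sym (identityˡ ε)
    ∑-∙ f g (x ∷ xs) = ≈-trans (∙-congˡ (∑-∙ f g xs)) (interchange _ _ _ _)

    ∑-single : (f : A → Carrier) → ∀ {xs x} → Unique xs → x ∈ xs →
               (∀ y → y ≢ x → f y ≈ ε) → ∑ f xs ≈ f x
    ∑-single f {y ∷ xs} (y∉ ∷ u) (here refl) h =
      ≈-trans (∙-congˡ (∑-ε f xs (λ z m → h z (λ e → All.lookup y∉ m (sym e))))) (identityʳ _)
    ∑-single f {y ∷ xs} (y∉ ∷ u) (there m) h =
      ≈-trans (∙-cong (h y (All.lookup y∉ m)) (∑-single f u m h)) (identityˡ _)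

  module _ {A B : Set} where

    ∑-map : (f : B → Carrier) (g : A → B) → ∀ xs → ∑ f (map g xs) ≈ ∑ (f ∘ g) xs
    ∑-map f g []       = ≈-refl
    ∑-map f g (x ∷ xs) = ∙-congˡ (∑-map f g xs)

    ∑-concatMap : (f : B → Carrier) (g : A → List B) → ∀ xs →
                  ∑ f (concatMap g xs) ≈ ∑ (λ x → ∑ f (g x)) xs
    ∑-concatMap f g []       = ≈-refl
    ∑-concatMap f g (x ∷ xs) = ≈-trans (∑-++ f (g x) (concatMap g xs)) (∙-congˡ (∑-concatMap f g xs))

    ∑-swap : (f : A → B → Carrier) → ∀ xs ys →
             ∑ (λ x → ∑ (f x) ys) xs ≈ ∑ (λ y → ∑ (λ x → f x y) xs) ys
    ∑-swap f []       ys = ≈-sym (∑-ε _ ys (λ _ _ → ≈-refl))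
    ∑-swap f (x ∷ xs) ys = ≈-trans (∙-congˡ (∑-swap f xs ys)) (≈-sym (∑-∙ (f x) _ ys))

  ∑-edges : ∀ {m d} (f : Edge m d → Carrier) →
            ∑ f (edges m d) ≈ ∑ (λ v → ∑ (λ k → f (v , k)) (allFin d)) (allVertices m d)
  ∑-edges {m} {d} f = ≈-trans (∑-concatMap f _ (allVertices m d))
    (∑-cong (λ v → ∑-map f (v ,_) (allFin d)) (allVertices m d))

module ∑ℤ = ListSum ℤP.+-0-commutativeMonoid
module ∑ℕ = ListSum ℕP.+-0-commutativeMonoid

allVertices-product : ∀ m d → allVertices m (suc d) ≡ cartesianProductWith _∷_ (allFin m) (allVertices m d)
allVertices-product m d = go (allFin m)
  where
  go : ∀ is → concatMap (λ i → map (i ∷_) (allVertices m d)) is ≡ cartesianProductWith _∷_ is (allVertices m d)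
  go []       = refl
  go (i ∷ is) = cong (map (i ∷_) (allVertices m d) ++_) (go is)

allVertices-complete : ∀ {m d} (v : Vertex m d) → v ∈ allVertices m d
allVertices-complete []              = here refl
allVertices-complete {m} {suc d} (i ∷ v) = subst ((i ∷ v) ∈_) (sym (allVertices-product m d))
  (∈-cartesianProductWith⁺ _∷_ (∈-allFin i) (allVertices-complete v))

allVertices-unique : ∀ m d → Unique (allVertices m d)
allVertices-unique m zero    = All.[] ∷ []
allVertices-unique m (suc d) = subst Unique (sym (allVertices-product m d))
  (UniqueP.cartesianProductWith⁺ _∷_ VecP.∷-injective (UniqueP.allFin⁺ m) (allVertices-unique m d))

toℕ-incr : ∀ {m} (i : Fin m) → suc (toℕ i) ℕ.< m → toℕ (incr i) ≡ suc (toℕ i)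
toℕ-incr {suc m} i lt = trans (FinP.toℕ-fromℕ< _) (m<n⇒m%n≡m lt)

toℕ-incr-wrap : ∀ {m} (i : Fin m) → suc (toℕ i) ≡ m → toℕ (incr i) ≡ 0
toℕ-incr-wrap {suc m} i e = trans (FinP.toℕ-fromℕ< _) (trans (cong (ℕ._% suc m) e) (n%n≡0 (suc m)))

toℕ-decr : ∀ {m} (i : Fin m) {j} → toℕ i ≡ suc j → toℕ (decr i) ≡ j
toℕ-decr {suc m} i {j} e = begin
  toℕ (decr i)           ≡⟨ FinP.toℕ-fromℕ< _ ⟩
  (toℕ i ℕ.+ m) ℕ.% suc m  ≡⟨ cong (λ x → (x ℕ.+ m) ℕ.% suc m) e ⟩
  (suc j ℕ.+ m) ℕ.% suc m  ≡⟨ cong (ℕ._% suc m) (sym (ℕP.+-suc j m)) ⟩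
  (j ℕ.+ suc m) ℕ.% suc m  ≡⟨ [m+n]%n≡m%n j (suc m) ⟩
  j ℕ.% suc m              ≡⟨ m<n⇒m%n≡m (ℕP.<⇒≤ (subst (ℕ._< suc m) e (FinP.toℕ<n i))) ⟩
  j                      ∎
  where open ≡-Reasoning

toℕ-decr-wrap : ∀ {m} (i : Fin m) → toℕ i ≡ 0 → suc (toℕ (decr i)) ≡ m
toℕ-decr-wrap {suc m} i e = cong suc (trans (FinP.toℕ-fromℕ< _)
  (trans (cong (λ x → (x ℕ.+ m) ℕ.% suc m) e) (m<n⇒m%n≡m (ℕP.n<1+n m))))

incr-decr : ∀ {m} (i : Fin m) → incr (decr i) ≡ i
incr-decr {m} i with toℕ i in e
... | zero  = FinP.toℕ-injective (trans (toℕ-incr-wrap (decr i) (toℕ-decr-wrap i e)) (sym e))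
... | suc j = FinP.toℕ-injective (trans (toℕ-incr (decr i) lt) (trans (cong suc (toℕ-decr i e)) (sym e)))
  where
  lt : suc (toℕ (decr i)) ℕ.< m
  lt = subst (ℕ._< m) (trans e (cong suc (sym (toℕ-decr i e)))) (FinP.toℕ<n i)

decr-incr : ∀ {m} (i : Fin m) → decr (incr i) ≡ i
decr-incr {m} i with suc (toℕ i) ℕP.≟ m
... | yes e = FinP.toℕ-injective (ℕP.suc-injective (trans (toℕ-decr-wrap (incr i) (toℕ-incr-wrap i e)) (sym e)))
... | no ne = FinP.toℕ-injective (toℕ-decr (incr i) (toℕ-incr i (ℕP.≤∧≢⇒< (FinP.toℕ<n i) ne)))

shift+-shift- : ∀ {m d} (v : Vertex m d) k → shift+ (shift- v k) k ≡ v
shift+-shift- v k = trans (VecP.updateAt-updateAt k v) (VecP.updateAt-id-local k v (incr-decr _))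

shift--shift+ : ∀ {m d} (v : Vertex m d) k → shift- (shift+ v k) k ≡ v
shift--shift+ v k = trans (VecP.updateAt-updateAt k v) (VecP.updateAt-id-local k v (decr-incr _))

at : ∀ {m d} → Vertex m d → Vertex m d → ℤ → ℤ
at v w a = if ⌊ v ≟V w ⌋ then a else + 0

at-≡ : ∀ {m d} {v w : Vertex m d} a → v ≡ w → at v w a ≡ a
at-≡ {v = v} {w} a e with v ≟V w
... | yes _ = refl
... | no ne = ⊥-elim (ne e)

at-≢ : ∀ {m d} {v w : Vertex m d} a → v ≢ w → at v w a ≡ + 0
at-≢ {v = v} {w} a ne with v ≟V w
... | yes e = ⊥-elim (ne e)
... | no _  = refl

addAt-at : ∀ {m d} (x : Load m d) w a v → addAt x w a v ≡ x v ℤ.+ at v w a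
addAt-at x w a v with v ≟V w
... | yes _ = refl
... | no _  = sym (ℤP.+-identityʳ (x v))

transfer : ∀ {m d} → Vertex m d → Vertex m d → ℕ → Vertex m d → ℤ
transfer w u f v = at v w (ℤ.- (+ f)) ℤ.+ at v u (+ f)

move-transfer : ∀ {m d} (x : Load m d) w u f v → move x w u f v ≡ x v ℤ.+ transfer w u f v
move-transfer x w u f v = trans (addAt-at (addAt x w (ℤ.- (+ f))) u (+ f) v)
  (trans (cong (ℤ._+ at v u (+ f)) (addAt-at x w (ℤ.- (+ f)) v)) (ℤP.+-assoc (x v) _ _))

transfer-≢ : ∀ {m d} {w u : Vertex m d} f {v} → v ≢ w → v ≢ u → transfer w u f v ≡ + 0
transfer-≢ f ne ne′ = cong₂ ℤ._+_ (at-≢ _ ne) (at-≢ _ ne′)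

contrib : ∀ {m d} → (Edge m d → ℕ) → Vertex m d → Edge m d → ℤ
contrib φ v (w , k) = transfer w (shift+ w k) (φ (w , k)) v

-- After exchanging the sums, each coordinate leaves one edge starting at `v` and one ending there.
-- Contributions are added rather than selected by cases, so short cycles, where edges coincide or
-- are loops, need no separate treatment.
divergence : ∀ {m d} (φ : Edge m d → ℕ) v →
  ∑ℤ.∑ (contrib φ v) (edges m d) ≡
  ∑ℤ.∑ (λ k → ℤ.- (+ φ (v , k)) ℤ.+ + φ (shift- v k , k)) (allFin d)
divergence {m} {d} φ v = begin
  ∑ (contrib φ v) (edges m d)
    ≡⟨ ∑-edges (contrib φ v) ⟩
  ∑ (λ w → ∑ (λ k → contrib φ v (w , k)) (allFin d)) (allVertices m d)
    ≡⟨ ∑-swap (λ w k → contrib φ v (w , k)) (allVertices m d) (allFin d) ⟩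
  ∑ (λ k → ∑ (λ w → contrib φ v (w , k)) (allVertices m d)) (allFin d)
    ≡⟨ ∑-cong (λ k → trans (∑-∙ _ _ (allVertices m d)) (cong₂ ℤ._+_ (out k) (inn k))) (allFin d) ⟩
  ∑ (λ k → ℤ.- (+ φ (v , k)) ℤ.+ + φ (shift- v k , k)) (allFin d) ∎
  where
  open ≡-Reasoning
  open ∑ℤ
  out : ∀ k → ∑ (λ w → at v w (ℤ.- (+ φ (w , k)))) (allVertices m d) ≡ ℤ.- (+ φ (v , k))
  out k = trans (∑-single _ (allVertices-unique m d) (allVertices-complete v) (λ w ne → at-≢ _ (ne ∘ sym)))
                (at-≡ _ refl)
  inn : ∀ k → ∑ (λ w → at v (shift+ w k) (+ φ (w , k))) (allVertices m d) ≡ + φ (shift- v k , k)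
  inn k = trans (∑-single _ (allVertices-unique m d) (allVertices-complete (shift- v k))
                   (λ w ne → at-≢ _ (λ e → ne (trans (sym (shift--shift+ w k)) (cong (λ z → shift- z k) (sym e))))))
                (at-≡ _ (sym (shift+-shift- v k)))

-- Blocks of side L and the cone around their centres

module Cone (T m N : ℕ) (fits : N ℕ.* suc (T ℕ.+ T) ℕ.≤ m) where

  L : ℕ
  L = suc (T ℕ.+ T)

  -- n counts the remaining steps: what happens outside the block spreads inwards by one site per step.
  Near : ℕ → ℕ → Fin m → Set
  Near n k i = (toℕ i ℕ./ L ≡ k) × (T ℕ.≤ toℕ i ℕ.% L ℕ.+ n) × (toℕ i ℕ.% L ℕ.≤ T ℕ.+ n)

  Near-suc : ∀ {n k i} → Near n k i → Near (suc n) k i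
  Near-suc {n} {k} {i} (e , l , u) =
    e , ℕP.≤-trans l (ℕP.+-monoʳ-≤ (toℕ i ℕ.% L) (ℕP.n≤1+n n)) , ℕP.≤-trans u (ℕP.+-monoʳ-≤ T (ℕP.n≤1+n n))

  %-block : ∀ r k → r ℕ.< L → (r ℕ.+ k ℕ.* L) ℕ.% L ≡ r
  %-block r k lt = trans ([m+kn]%n≡m%n r k L) (m<n⇒m%n≡m lt)

  /-block : ∀ r k → r ℕ.< L → (r ℕ.+ k ℕ.* L) ℕ./ L ≡ k
  /-block r k lt = trans (+-distrib-/-∣ʳ r (divides-refl k)) (cong₂ ℕ._+_ (m<n⇒m/n≡0 lt) (m*n/n≡m k L))

  decompose : ∀ {k} (i : Fin m) → toℕ i ℕ./ L ≡ k → toℕ i ≡ toℕ i ℕ.% L ℕ.+ k ℕ.* L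
  decompose i refl = m≡m%n+[m/n]*n (toℕ i) L

  -- With n < T the new offset is at most 2T, so the step crosses neither the border of the block
  -- nor, as the blocks fit into m, the seam of the torus.
  Near-incr : ∀ {n k i} → n ℕ.< T → k ℕ.< N → Near n k i →
              Near (suc n) k (incr i) × toℕ (incr i) ℕ.% L ≡ suc (toℕ i ℕ.% L)
  Near-incr {n} {k} {i} n<T k<N (e , l , u) =
    ( trans (cong (ℕ._/ L) eq) (/-block (suc r) k lt)
    , subst (λ z → T ℕ.≤ z ℕ.+ suc n) (sym re) (ℕP.≤-trans l (ℕP.+-mono-≤ (ℕP.n≤1+n r) (ℕP.n≤1+n n)))
    , subst₂ ℕ._≤_ (sym re) (sym (ℕP.+-suc T n)) (s≤s u) ) , re
    where
    r = toℕ i ℕ.% L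
    lt : suc r ℕ.< L
    lt = s≤s (ℕP.≤-trans (s≤s u) (ℕP.+-monoʳ-< T n<T))
    suc-i : suc (toℕ i) ≡ suc r ℕ.+ k ℕ.* L
    suc-i = cong suc (decompose i e)
    inside : suc (toℕ i) ℕ.< m
    inside = subst (ℕ._< m) (sym suc-i)
      (ℕP.<-≤-trans (ℕP.+-monoˡ-< (k ℕ.* L) lt) (ℕP.≤-trans (ℕP.*-monoˡ-≤ L k<N) fits))
    eq : toℕ (incr i) ≡ suc r ℕ.+ k ℕ.* L
    eq = trans (toℕ-incr i inside) suc-i
    re : toℕ (incr i) ℕ.% L ≡ suc r
    re = trans (cong (ℕ._% L) eq) (%-block (suc r) k lt)

  Near-decr : ∀ {n k i} → n ℕ.< T → Near n k i →
              Near (suc n) k (decr i) × toℕ i ℕ.% L ≡ suc (toℕ (decr i) ℕ.% L)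
  Near-decr {n} {k} {i} n<T (e , l , u) with toℕ i ℕ.% L in re
  ... | zero  = ⊥-elim (ℕP.<-irrefl refl (ℕP.<-≤-trans n<T l))
  ... | suc r =
    ( trans (cong (ℕ._/ L) eq) (/-block r k lt)
    , subst (λ z → T ℕ.≤ z ℕ.+ suc n) (sym re′) (subst (T ℕ.≤_) (sym (ℕP.+-suc r n)) l)
    , subst (ℕ._≤ T ℕ.+ suc n) (sym re′) (ℕP.≤-trans (ℕP.n≤1+n r) (ℕP.≤-trans u (ℕP.+-monoʳ-≤ T (ℕP.n≤1+n n)))) )
    , cong suc (sym re′)
    where
    lt : r ℕ.< L
    lt = ℕP.<⇒≤ (subst (ℕ._< L) re (m%n<n (toℕ i) L))
    eq : toℕ (decr i) ≡ r ℕ.+ k ℕ.* L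
    eq = toℕ-decr i (trans (decompose i e) (cong (ℕ._+ k ℕ.* L) re))
    re′ : toℕ (decr i) ℕ.% L ≡ r
    re′ = trans (cong (ℕ._% L) eq) (%-block r k lt)

  module _ {d : ℕ} where

    InCone : ℕ → (Fin d → ℕ) → Vertex m d → Set
    InCone n κ v = ∀ j → Near n (κ j) (lookup v j)

    InCone-shift+ : ∀ {n κ v} k → n ℕ.< T → (∀ j → κ j ℕ.< N) → InCone n κ v → InCone (suc n) κ (shift+ v k)
    InCone-shift+ {n} {κ} {v} k n<T κ<N c j with j FinP.≟ k
    ... | yes refl = subst (Near (suc n) (κ j)) (sym (VecP.lookup∘updateAt j v)) (proj₁ (Near-incr n<T (κ<N j) (c j)))
    ... | no ne    = subst (Near (suc n) (κ j)) (sym (VecP.lookup∘updateAt′ j k ne v)) (Near-suc {i = lookup v j} (c j))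

    InCone-shift- : ∀ {n κ v} k → n ℕ.< T → InCone n κ v → InCone (suc n) κ (shift- v k)
    InCone-shift- {n} {κ} {v} k n<T c j with j FinP.≟ k
    ... | yes refl = subst (Near (suc n) (κ j)) (sym (VecP.lookup∘updateAt j v)) (proj₁ (Near-decr n<T (c j)))
    ... | no ne    = subst (Near (suc n) (κ j)) (sym (VecP.lookup∘updateAt′ j k ne v)) (Near-suc {i = lookup v j} (c j))

  -- Counting the edges of a block

  hit : ℕ → Fin m → ℕ
  hit k i = if ⌊ toℕ i ℕ./ L ℕP.≟ k ⌋ then 1 else 0

  -- A numerical indicator in product form, so that its sum over all vertices factorises coordinate
  -- by coordinate.
  inBlock : ∀ {d} → (Fin d → ℕ) → Vertex m d → ℕ
  inBlock κ []      = 1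
  inBlock κ (i ∷ v) = hit (κ Fin.zero) i ℕ.* inBlock (κ ∘ Fin.suc) v

  hit-≡ : ∀ k i → toℕ i ℕ./ L ≡ k → hit k i ≡ 1
  hit-≡ k i e with toℕ i ℕ./ L ℕP.≟ k
  ... | yes _ = refl
  ... | no ne = ⊥-elim (ne e)

  hit-≢ : ∀ k i → toℕ i ℕ./ L ≢ k → hit k i ≡ 0
  hit-≢ k i ne with toℕ i ℕ./ L ℕP.≟ k
  ... | yes e = ⊥-elim (ne e)
  ... | no _  = refl

  inBlock-cone : ∀ {d n} κ (v : Vertex m d) → InCone n κ v → inBlock κ v ≡ 1
  inBlock-cone κ []      c = refl
  inBlock-cone κ (i ∷ v) c =
    cong₂ ℕ._*_ (hit-≡ _ i (proj₁ (c Fin.zero))) (inBlock-cone (κ ∘ Fin.suc) v (c ∘ Fin.suc))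

  inBlock-off : ∀ {d} κ (v : Vertex m (suc d)) → toℕ (lookup v Fin.zero) ℕ./ L ≢ κ Fin.zero → inBlock κ v ≡ 0
  inBlock-off κ (i ∷ v) ne = cong (ℕ._* inBlock (κ ∘ Fin.suc) v) (hit-≢ _ i ne)

  module _ {A : Set} where
    open ∑ℕ
    ∑-*ʳ : (f : A → ℕ) (c : ℕ) → ∀ xs → ∑ (λ x → f x ℕ.* c) xs ≡ ∑ f xs ℕ.* c
    ∑-*ʳ f c []       = refl
    ∑-*ʳ f c (x ∷ xs) = trans (cong (f x ℕ.* c ℕ.+_) (∑-*ʳ f c xs)) (sym (ℕP.*-distribʳ-+ c (f x) (∑ f xs)))

    ∑-*ˡ : (c : ℕ) (f : A → ℕ) → ∀ xs → ∑ (λ x → c ℕ.* f x) xs ≡ c ℕ.* ∑ f xs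
    ∑-*ˡ c f []       = sym (ℕP.*-zeroʳ c)
    ∑-*ˡ c f (x ∷ xs) = trans (cong (c ℕ.* f x ℕ.+_) (∑-*ˡ c f xs)) (sym (ℕP.*-distribˡ-+ c (f x) (∑ f xs)))

    ∑-const : (c : ℕ) → ∀ (xs : List A) → ∑ (λ _ → c) xs ≡ List.length xs ℕ.* c
    ∑-const c []       = refl
    ∑-const c (x ∷ xs) = cong (c ℕ.+_) (∑-const c xs)

  -- Generalised over the first value a so that allFin can be consumed from the front.
  private
    count : ℕ → ℕ → ℕ
    count k a = if ⌊ a ℕ./ L ℕP.≟ k ⌋ then 1 else 0

    count-bound : ∀ k n a → let s = ∑ℕ.∑ (λ i → count k (a ℕ.+ toℕ i)) (allFin n) in
                  (s ℕ.≤ suc k ℕ.* L ℕ.∸ a) × (s ℕ.≤ L)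
    count-bound k zero    a = z≤n , z≤n
    count-bound k (suc n) a = subst (λ s → (s ℕ.≤ suc k ℕ.* L ℕ.∸ a) × (s ℕ.≤ L)) (sym split) main
      where
      open ∑ℕ
      s′ : ℕ
      s′ = ∑ (λ i → count k (suc a ℕ.+ toℕ i)) (allFin n)
      ih = count-bound k n (suc a)
      split : ∑ (λ i → count k (a ℕ.+ toℕ i)) (allFin (suc n)) ≡ count k a ℕ.+ s′
      split = cong₂ ℕ._+_ (cong (count k) (ℕP.+-identityʳ a))
        (trans (cong (∑ (λ i → count k (a ℕ.+ toℕ i))) (sym (ListP.map-tabulate {n = n} (λ i → i) Fin.suc)))
          (trans (∑-map (λ i → count k (a ℕ.+ toℕ i)) Fin.suc (allFin n))
            (∑-cong (λ i → cong (count k) (ℕP.+-suc a (toℕ i))) (allFin n))))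
      main : (count k a ℕ.+ s′ ℕ.≤ suc k ℕ.* L ℕ.∸ a) × (count k a ℕ.+ s′ ℕ.≤ L)
      main with a ℕ./ L ℕP.≟ k
      ... | no _  = ℕP.≤-trans (proj₁ ih) (ℕP.∸-monoʳ-≤ (suc k ℕ.* L) (ℕP.n≤1+n a)) , proj₂ ih
      -- At a hit the first bound implies the second: a ≥ kL leaves at most L values up to (k + 1)L.
      ... | yes e = first , ℕP.≤-trans first (ℕP.≤-trans (ℕP.∸-monoʳ-≤ (suc k ℕ.* L) kL≤a)
                              (ℕP.≤-reflexive (ℕP.m+n∸n≡m L (k ℕ.* L))))
        where
        kL≤a : k ℕ.* L ℕ.≤ a
        kL≤a = subst (λ z → z ℕ.* L ℕ.≤ a) e (m/n*n≤m a L)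
        a<k+1L : a ℕ.< suc k ℕ.* L
        a<k+1L = subst₂ ℕ._<_ (sym (trans (m≡m%n+[m/n]*n a L) (cong (λ z → a ℕ.% L ℕ.+ z ℕ.* L) e))) refl
          (ℕP.+-monoˡ-< (k ℕ.* L) (m%n<n a L))
        first : suc s′ ℕ.≤ suc k ℕ.* L ℕ.∸ a
        first = ℕP.≤-trans (s≤s (proj₁ ih)) (ℕP.≤-reflexive (sym (ℕP.+-∸-assoc 1 a<k+1L)))

  ∑-inBlock : ∀ d (κ : Fin d → ℕ) → ∑ℕ.∑ (inBlock κ) (allVertices m d) ℕ.≤ L ℕ.^ d
  ∑-inBlock zero    κ = ℕP.≤-refl
  ∑-inBlock (suc d) κ = begin
    ∑ (inBlock κ) (allVertices m (suc d))
      ≡⟨ ∑-concatMap (inBlock κ) _ (allFin m) ⟩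
    ∑ (λ i → ∑ (inBlock κ) (map (i ∷_) (allVertices m d))) (allFin m)
      ≡⟨ ∑-cong (λ i → trans (∑-map (inBlock κ) (i ∷_) (allVertices m d)) (∑-*ˡ (hit k i) _ (allVertices m d))) (allFin m) ⟩
    ∑ (λ i → hit k i ℕ.* rest) (allFin m)
      ≡⟨ ∑-*ʳ (hit k) rest (allFin m) ⟩
    ∑ (hit k) (allFin m) ℕ.* rest
      ≤⟨ ℕP.*-mono-≤ (proj₂ (count-bound k m 0)) (∑-inBlock d (κ ∘ Fin.suc)) ⟩
    L ℕ.* L ℕ.^ d ∎
    where
    open ℕP.≤-Reasoning
    open ∑ℕ
    k = κ Fin.zero
    rest = ∑ (inBlock (κ ∘ Fin.suc)) (allVertices m d)

  edgesInBlock : ∀ {d} → (Fin d → ℕ) → List (Edge m d) → ℕ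
  edgesInBlock κ = ∑ℕ.∑ (λ e → inBlock κ (proj₁ e))

  edgesInBlock-bound : ∀ d (κ : Fin d → ℕ) → edgesInBlock κ (edges m d) ℕ.≤ d ℕ.* L ℕ.^ d
  edgesInBlock-bound d κ = begin
    ∑ (λ e → inBlock κ (proj₁ e)) (edges m d)
      ≡⟨ ∑-edges {m} {d} _ ⟩
    ∑ (λ v → ∑ (λ _ → inBlock κ v) (allFin d)) (allVertices m d)
      ≡⟨ ∑-cong (λ v → trans (∑-const (inBlock κ v) (allFin d)) (cong (ℕ._* inBlock κ v) (ListP.length-tabulate {n = d} (λ i → i)))) (allVertices m d) ⟩
    ∑ (λ v → d ℕ.* inBlock κ v) (allVertices m d)
      ≡⟨ ∑-*ˡ d (inBlock κ) (allVertices m d) ⟩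
    d ℕ.* ∑ (inBlock κ) (allVertices m d)
      ≤⟨ ℕP.*-monoʳ-≤ d (∑-inBlock d κ) ⟩
    d ℕ.* L ℕ.^ d ∎
    where
    open ℕP.≤-Reasoning
    open ∑ℕ

-- One step of the algorithm

r≤D⇒0≤1-r/D : ∀ D .{{_ : NonZero D}} r → r ℕ.≤ D → 0ℚ ≤ 1ℚ - + r / D
r≤D⇒0≤1-r/D D r le = subst (0ℚ ≤_) (sym (1-frac D {r} {D ℕ.∸ r} (ℕP.m+[n∸m]≡n le))) (0≤frac D (D ℕ.∸ r))

p+[1-p] : ∀ p → p + (1ℚ - p) ≡ 1ℚ
p+[1-p] = solve 1 (λ p → p :+ (con 1ℚ :- p) := con 1ℚ) refl
  where open +-*-Solver

-- The two-point average formed by `expStep` on one edge, with the rest of the step abstracted to a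
-- function of the flow.
rounded : (D : ℕ) → .{{_ : NonZero D}} → ℕ → (ℕ → ℚ) → ℚ
rounded D x E = + (x ℕ.% D) / D * E (suc (x ℕ./ D)) + (1ℚ - + (x ℕ.% D) / D) * E (x ℕ./ D)

rounded-≥ : ∀ D .{{_ : NonZero D}} x (E : ℕ → ℚ) {B} → (∀ f → B ≤ E f) → B ≤ rounded D x E
rounded-≥ D x E h = mix-≤ {+ (x ℕ.% D) / D} {1ℚ - + (x ℕ.% D) / D}
  (0≤frac D (x ℕ.% D)) (r≤D⇒0≤1-r/D D (x ℕ.% D) (ℕP.<⇒≤ (m%n<n x D)))
  (p+[1-p] (+ (x ℕ.% D) / D)) (h (suc (x ℕ./ D))) (h (x ℕ./ D))

-- For edges about whose loads nothing is known: a bound valid for either orientation and every flow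
-- survives averaging.
expStep-≥ : ∀ {m} d .{{_ : NonZero d}} (old : Load m d) w k es acc {κ B} →
  (∀ f → B ≤ expStep d old es (move acc w (shift+ w k) f) κ) →
  (∀ f → B ≤ expStep d old es (move acc (shift+ w k) w f) κ) →
  B ≤ expStep d old ((w , k) ∷ es) acc κ
expStep-≥ d old w k es acc {κ} h h′ with old (shift+ w k) ℤP.≤? old w
... | yes _ = rounded-≥ (4 ℕ.* d) {{nz4 d}} ℤ.∣ old w ℤ.- old (shift+ w k) ∣
                (λ f → expStep d old es (move acc w (shift+ w k) f) κ) h
... | no _  = rounded-≥ (4 ℕ.* d) {{nz4 d}} ℤ.∣ old (shift+ w k) ℤ.- old w ∣
                (λ f → expStep d old es (move acc (shift+ w k) w f) κ) h′

expStep-downhill : ∀ {m} d .{{_ : NonZero d}} (old : Load m d) w k es acc {κ B} →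
  old (shift+ w k) ℤ.≤ old w →
  B ≤ rounded (4 ℕ.* d) {{nz4 d}} ℤ.∣ old w ℤ.- old (shift+ w k) ∣
        (λ f → expStep d old es (move acc w (shift+ w k) f) κ) →
  B ≤ expStep d old ((w , k) ∷ es) acc κ
expStep-downhill d old w k es acc le h with old (shift+ w k) ℤP.≤? old w
... | yes _  = h
... | no nle = ⊥-elim (nle le)

expStep-nonneg : ∀ {m} d .{{_ : NonZero d}} (old : Load m d) es acc {κ} →
  (∀ x → 0ℚ ≤ κ x) → 0ℚ ≤ expStep d old es acc κ
expStep-nonneg d old []             acc h = h acc
expStep-nonneg d old ((w , k) ∷ es) acc h = expStep-≥ d old w k es acc
  (λ f → expStep-nonneg d old es _ h) (λ f → expStep-nonneg d old es _ h)

hitProb-nonneg : ∀ {m} d .{{_ : NonZero d}} K p q n (x : Load m d) ξ → 0ℚ ≤ hitProb d K p q n x ξ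
hitProb-nonneg {m} d K p q zero x ξ = indicator-nonneg (bigDev m d K p q x ξ)
  where
  indicator-nonneg : ∀ B → 0ℚ ≤ indicator B
  indicator-nonneg true  = 0≤1
  indicator-nonneg false = ≤-refl
hitProb-nonneg {m} d K p q (suc n) x ξ = if-nonneg (bigDev m d K p q x ξ)
  (expStep-nonneg d x (edges m d) x (λ x′ → hitProb-nonneg d K p q n x′ (diffuse d ξ)))
  where
  if-nonneg : ∀ B {y} → 0ℚ ≤ y → 0ℚ ≤ (if B then 1ℚ else y)
  if-nonneg true  _   = 0≤1
  if-nonneg false 0≤y = 0≤y

hitProb-bigDev : ∀ {m} d .{{_ : NonZero d}} {K p q} n {x : Load m d} {ξ} →
  bigDev m d K p q x ξ ≡ true → hitProb d K p q n x ξ ≡ 1ℚ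
hitProb-bigDev d zero    e = cong indicator e
hitProb-bigDev {m} d {K} {p} {q} (suc n) {x} {ξ} e =
  cong (λ B → if B then 1ℚ else expStep d x (edges m d) x (λ x′ → hitProb d K p q n x′ (diffuse d ξ))) e

bigDev-witness : ∀ {m} d {K p q} {x : Load m d} {ξ} v →
  K * ℤtoℚ (+ (⌊log₂ (m ℕ.^ d) ⌋ ℕ.^ p)) ≤ powℚ ℚ.∣ ℤtoℚ (x v) - ξ v ∣ q →
  bigDev m d K p q x ξ ≡ true
bigDev-witness {m} d v h = Equivalence.to BoolP.T-≡ (any⁺ _ (lose (allVertices-complete v) (fromWitness h)))

sumℚ-const : ∀ {A : Set} (f : A → ℚ) {c} xs → (∀ x → f x ≡ c) → sumℚ (List.map f xs) ≡ ι (List.length xs) * c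
sumℚ-const f {c} []       h = sym (*-zeroˡ c)
sumℚ-const f {c} (x ∷ xs) h = begin
  f x + sumℚ (List.map f xs)           ≡⟨ cong₂ _+_ (h x) (sumℚ-const f xs h) ⟩
  c + ι (List.length xs) * c           ≡⟨ solve 2 (λ c n → c :+ n :* c := (con 1ℚ :+ n) :* c) refl c (ι (List.length xs)) ⟩
  (1ℚ + ι (List.length xs)) * c        ≡⟨ cong (_* c) (sym (ι-+ 1 (List.length xs))) ⟩
  ι (suc (List.length xs)) * c         ∎
  where open ≡-Reasoning
        open +-*-Solver

-- The script on disjoint blocks

module Blocks (d′ m T N : ℕ) (fits : N ℕ.* suc (T ℕ.+ T) ℕ.≤ m) where
  open Cone T m N fits

  d = suc d′
  D = 4 ℕ.* d

  c : ℚ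
  c = (+ 1 / D) {{nz4 d}}

  0≤c : 0ℚ ≤ c
  0≤c = 0≤frac D {{nz4 d}} 1

  c≤1 : c ≤ 1ℚ
  c≤1 = subst (c ≤_) (frac-self D {{nz4 d}}) (frac-mono D {{nz4 d}} {1} {D} (s≤s z≤n))

  offset : Vertex m d → ℕ
  offset v = toℕ (lookup v Fin.zero) ℕ.% L

  profile : (ℕ → ℕ) → ℕ → ℕ
  profile b o = 2 ℕ.* (L ℕ.∸ o) ℕ.+ b o

  -- The blocks differ in the first coordinate only. Confining the others to one block as well keeps
  -- the number of prescribed edges at d L^d, independent of m.
  block : ℕ → Fin d → ℕ
  block k Fin.zero    = k
  block k (Fin.suc _) = 0

  block-< : ∀ {k} → k ℕ.< N → ∀ j → block k j ℕ.< N
  block-< k<N Fin.zero    = k<N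
  block-< k<N (Fin.suc _) = ℕP.≤-<-trans z≤n k<N

  flow : ℕ → Edge m d → ℕ
  flow s (w , Fin.zero)  = below s (offset w)
  flow s (w , Fin.suc _) = 0

  offset<L : ∀ v → offset v ℕ.< L
  offset<L v = m%n<n (toℕ (lookup v Fin.zero)) L

  offset-shift- : ∀ {n k v} → n ℕ.< T → InCone n (block k) v → offset v ≡ suc (offset (shift- v Fin.zero))
  offset-shift- {v = v} n<T h =
    trans (proj₂ (Near-decr n<T (h Fin.zero)))
          (cong (λ i → suc (toℕ i ℕ.% L)) (sym (VecP.lookup∘updateAt Fin.zero v)))

  offset-shift+ : ∀ {n k v} → n ℕ.< T → k ℕ.< N → InCone n (block k) v → offset (shift+ v Fin.zero) ≡ suc (offset v)
  offset-shift+ {v = v} n<T k<N h =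
    trans (cong (λ i → toℕ i ℕ.% L) (VecP.lookup∘updateAt Fin.zero v))
          (proj₂ (Near-incr n<T k<N (h Fin.zero)))

  offset-shift+-suc : ∀ v j → offset (shift+ v (Fin.suc j)) ≡ offset v
  offset-shift+-suc v j = cong (λ i → toℕ i ℕ.% L) (VecP.lookup∘updateAt′ Fin.zero (Fin.suc j) (λ ()) v)

  offset-shift--suc : ∀ v j → offset (shift- v (Fin.suc j)) ≡ offset v
  offset-shift--suc v j = cong (λ i → toℕ i ℕ.% L) (VecP.lookup∘updateAt′ Fin.zero (Fin.suc j) (λ ()) v)

  -- Sites before `s` pass their token on, and `s` keeps it. This needs consecutive offsets, which
  -- the jump of the sawtooth breaks at block borders but not inside the cone.
  flow-divergence : ∀ {n k v} s → n ℕ.< T → InCone n (block k) v →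
    ∑ℤ.∑ (contrib (flow s) v) (edges m d) ≡ + δ s (offset v)
  flow-divergence {v = v} s n<T h = begin
    ∑ℤ.∑ (contrib (flow s) v) (edges m d)
      ≡⟨ divergence (flow s) v ⟩
    ∑ℤ.∑ (λ k → ℤ.- (+ flow s (v , k)) ℤ.+ + flow s (shift- v k , k)) (allFin d)
      ≡⟨ ∑ℤ.∑-single (λ k → ℤ.- (+ flow s (v , k)) ℤ.+ + flow s (shift- v k , k)) (UniqueP.allFin⁺ d) (∈-allFin Fin.zero) (λ { Fin.zero ne → ⊥-elim (ne refl) ; (Fin.suc j) _ → refl }) ⟩
    ℤ.- (+ below s (offset v)) ℤ.+ + below s o
      ≡⟨ cong (λ z → ℤ.- (+ below s z) ℤ.+ + below s o) e ⟩
    ℤ.- (+ below s (suc o)) ℤ.+ + below s o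
      ≡⟨ cong (λ z → ℤ.- (+ below s (suc o)) ℤ.+ + z) (below-suc s o) ⟩
    ℤ.- (+ below s (suc o)) ℤ.+ (+ below s (suc o) ℤ.+ + δ s (suc o))
      ≡⟨ sym (ℤP.+-assoc (ℤ.- (+ below s (suc o))) _ _) ⟩
    ℤ.- (+ below s (suc o)) ℤ.+ + below s (suc o) ℤ.+ + δ s (suc o)
      ≡⟨ cong (ℤ._+ + δ s (suc o)) (ℤP.+-inverseˡ (+ below s (suc o))) ⟩
    + 0 ℤ.+ + δ s (suc o)
      ≡⟨ ℤP.+-identityˡ _ ⟩
    + δ s (suc o)
      ≡⟨ cong (λ z → + δ s z) (sym e) ⟩
    + δ s (offset v) ∎
    where
    open ≡-Reasoning
    o = offset (shift- v Fin.zero)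
    e : offset v ≡ suc o
    e = offset-shift- {v = v} n<T h

  profile-gap : ∀ {b} o → Lip b → o ℕ.< L →
    Σ ℕ λ t → (profile b o ≡ profile b (suc o) ℕ.+ t) × (1 ℕ.≤ t) × (t ℕ.≤ 3)
  profile-gap {b} o lip o<L = t , eq
    , ℕP.m<n⇒0<n∸m (s≤s (proj₂ (lip o)))
    , ℕP.m≤n+o⇒m∸n≤o _ (b (suc o)) (subst (2 ℕ.+ b o ℕ.≤_) (ℕP.+-comm 3 (b (suc o))) (s≤s (s≤s (proj₁ (lip o)))))
    where
    open ≡-Reasoning
    t = 2 ℕ.+ b o ℕ.∸ b (suc o)
    A = 2 ℕ.* (L ℕ.∸ suc o)
    eq : profile b o ≡ profile b (suc o) ℕ.+ t
    eq = begin
      2 ℕ.* (L ℕ.∸ o) ℕ.+ b o           ≡⟨ cong (λ z → 2 ℕ.* z ℕ.+ b o) (ℕP.+-∸-assoc 1 o<L) ⟩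
      2 ℕ.* suc (L ℕ.∸ suc o) ℕ.+ b o   ≡⟨ cong (ℕ._+ b o) (ℕP.*-distribˡ-+ 2 1 (L ℕ.∸ suc o)) ⟩
      2 ℕ.+ A ℕ.+ b o                   ≡⟨ cong (ℕ._+ b o) (ℕP.+-comm 2 A) ⟩
      A ℕ.+ 2 ℕ.+ b o                   ≡⟨ ℕP.+-assoc A 2 (b o) ⟩
      A ℕ.+ (2 ℕ.+ b o)                 ≡⟨ cong (A ℕ.+_) (sym (ℕP.m+[n∸m]≡n (ℕP.m≤n⇒m≤1+n (proj₂ (lip o))))) ⟩
      A ℕ.+ (b (suc o) ℕ.+ t)           ≡⟨ sym (ℕP.+-assoc A (b (suc o)) t) ⟩
      A ℕ.+ b (suc o) ℕ.+ t             ∎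

  Agree : ℕ → (ℕ → ℕ) → ℕ → Load m d → Set
  Agree n b k x = ∀ v → InCone n (block k) v → x v ≡ + profile b (offset v)

  -- flags k = true: block k has followed the script so far.
  weigh : Bool → ℕ → ℚ
  weigh b e = if b then powℚ c e else 0ℚ

  weigh-≤1 : ∀ b e → weigh b e ≤ 1ℚ
  weigh-≤1 true  e = powℚ-≤1 0≤c c≤1 e
  weigh-≤1 false e = 0≤1

  weigh-anti : ∀ b {e e′} → e′ ℕ.≤ e → weigh b e ≤ weigh b e′
  weigh-anti true  le = powℚ-anti 0≤c c≤1 le
  weigh-anti false le = ≤-refl

  weight : (ℕ → Bool) → (ℕ → ℕ) → ℕ → ℚ
  weight flags e k = weigh (flags k) (e k)

  weight-≤1 : ∀ flags e k → weight flags e k ≤ 1ℚ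
  weight-≤1 flags e k = weigh-≤1 (flags k) (e k)

  weight-anti : ∀ flags {e e′} → (∀ k → e′ k ℕ.≤ e k) → ∀ k → weight flags e k ≤ weight flags e′ k
  weight-anti flags le k = weigh-anti (flags k) (le k)

  switchOff : ℕ → (ℕ → Bool) → ℕ → Bool
  switchOff k flags j = if ⌊ j ℕP.≟ k ⌋ then false else flags j

  switchOff-true : ∀ {k flags j} → switchOff k flags j ≡ true → (j ≢ k) × (flags j ≡ true)
  switchOff-true {k} {flags} {j} e with j ℕP.≟ k
  ... | no ne = ne , e

  switchOff-≢ : ∀ {k flags j} → j ≢ k → switchOff k flags j ≡ flags j
  switchOff-≢ {k} {flags} {j} ne with j ℕP.≟ k
  ... | yes e = ⊥-elim (ne e)
  ... | no _  = refl

  switchOff-refl : ∀ {k flags} → switchOff k flags k ≡ false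
  switchOff-refl {k} with k ℕP.≟ k
  ... | yes _ = refl
  ... | no ne = ⊥-elim (ne refl)

  -- The supermartingale inequality for one rounding. The scripted outcome, of probability p ≥ c,
  -- saves block `k₀` one factor c; any other outcome gives the block up. Its failure factor
  -- averages to p(1 - ρ) + q = 1 - pρ ≤ 1 - cρ, and the other factors do not move.
  follow : ∀ {p q X Y flags k₀ e e′} → 0ℚ ≤ p → 0ℚ ≤ q → p + q ≡ 1ℚ → c ≤ p →
    k₀ ℕ.< N → flags k₀ ≡ true → e k₀ ≡ suc (e′ k₀) → (∀ k → k ≢ k₀ → e k ≡ e′ k) →
    1ℚ - failProb N (weight flags e′) ≤ X →
    1ℚ - failProb N (weight (switchOff k₀ flags) e′) ≤ Y →
    1ℚ - failProb N (weight flags e) ≤ p * X + q * Y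
  follow {p} {q} {X} {Y} {flags} {k₀} {e} {e′} hp hq pq cp k₀<N fl e₀ e≢ hX hY = begin
    1ℚ - failProb N (weight flags e)
      ≤⟨ 1-anti (failProb-mix {p} {q} k₀ N k₀<N (weight-≤1 flags e) off₁ off₂ at-k₀) ⟩
    1ℚ - (p * F₁ + q * F₂)
      ≡⟨ cong (_- (p * F₁ + q * F₂)) (sym pq) ⟩
    (p + q) - (p * F₁ + q * F₂)
      ≡⟨ solve 4 (λ p q a b → (p :+ q) :- (p :* a :+ q :* b) := p :* (con 1ℚ :- a) :+ q :* (con 1ℚ :- b)) refl p q F₁ F₂ ⟩
    p * (1ℚ - F₁) + q * (1ℚ - F₂)
      ≤⟨ +-mono-≤ (*-mono-ʳ hp hX) (*-mono-ʳ hq hY) ⟩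
    p * X + q * Y ∎
    where
    open ≤-Reasoning
    open +-*-Solver
    F₁ = failProb N (weight flags e′)
    F₂ = failProb N (weight (switchOff k₀ flags) e′)
    ρ = powℚ c (e′ k₀)
    off₁ : ∀ j → j ≢ k₀ → weight flags e′ j ≡ weight flags e j
    off₁ j ne = cong (weigh (flags j)) (sym (e≢ j ne))
    off₂ : ∀ j → j ≢ k₀ → weight (switchOff k₀ flags) e′ j ≡ weight flags e j
    off₂ j ne = trans (cong (λ z → weigh z (e′ j)) (switchOff-≢ {k₀} {flags} ne)) (off₁ j ne)
    on₁ : weight flags e′ k₀ ≡ ρ
    on₁ = cong (λ z → weigh z (e′ k₀)) fl
    on₂ : weight (switchOff k₀ flags) e′ k₀ ≡ 0ℚ
    on₂ = cong (λ z → weigh z (e′ k₀)) (switchOff-refl {k₀} {flags})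
    on : weight flags e k₀ ≡ c * ρ
    on = trans (cong (λ z → weigh z (e k₀)) fl) (cong (powℚ c) e₀)
    at-k₀ : p * (1ℚ - weight flags e′ k₀) + q * (1ℚ - weight (switchOff k₀ flags) e′ k₀) ≤ 1ℚ - weight flags e k₀
    at-k₀ = begin
      p * (1ℚ - weight flags e′ k₀) + q * (1ℚ - weight (switchOff k₀ flags) e′ k₀)
        ≡⟨ cong₂ (λ y z → p * (1ℚ - y) + q * (1ℚ - z)) on₁ on₂ ⟩
      p * (1ℚ - ρ) + q * (1ℚ - 0ℚ)
        ≡⟨ solve 3 (λ p q r → p :* (con 1ℚ :- r) :+ q :* (con 1ℚ :- con 0ℚ) := (p :+ q) :- p :* r) refl p q ρ ⟩
      (p + q) - p * ρ
        ≡⟨ cong (_- p * ρ) pq ⟩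
      1ℚ - p * ρ
        ≤⟨ 1-anti (*-mono-ˡ (powℚ-nonneg 0≤c c≤1 (e′ k₀)) cp) ⟩
      1ℚ - c * ρ
        ≡⟨ cong (λ z → 1ℚ - z) (sym on) ⟩
      1ℚ - weight flags e k₀ ∎

  -- As 3 < 4 ≤ D, the quotient is 0 and the flow is 0 or 1, with probabilities (D - t)/D and t/D.
  -- The former is always at least 1/D, the latter as soon as t ≥ 1. The alternative outcome `f′` is
  -- left arbitrary.
  rounding-bound : ∀ {B x t} (E : ℕ → ℚ) f → x ≡ t → t ℕ.≤ 3 → f ≡ 0 ⊎ (f ≡ 1 × 1 ℕ.≤ t) →
    (∀ p q → 0ℚ ≤ p → 0ℚ ≤ q → p + q ≡ 1ℚ → c ≤ p → ∀ f′ → B ≤ p * E f + q * E f′) →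
    B ≤ rounded D {{nz4 d}} x E
  rounding-bound {B} {x} E f refl x≤3 cases mixed =
    subst₂ (λ q r → B ≤ (+ r / D) {{nz4 d}} * E (suc q) + (1ℚ - (+ r / D) {{nz4 d}}) * E q)
      (sym (m<n⇒m/n≡0 {{nz4 d}} x<D)) (sym (m<n⇒m%n≡m {{nz4 d}} x<D)) (split cases)
    where
    x<D : x ℕ.< D
    x<D = ℕP.<-≤-trans (s≤s x≤3) (ℕP.*-monoʳ-≤ 4 (s≤s z≤n))
    r = (+ x / D) {{nz4 d}}
    0≤r : 0ℚ ≤ r
    0≤r = 0≤frac D {{nz4 d}} x
    1-r : 1ℚ - r ≡ (+ (D ℕ.∸ x) / D) {{nz4 d}}
    1-r = 1-frac D {{nz4 d}} {x} {D ℕ.∸ x} (ℕP.m+[n∸m]≡n (ℕP.<⇒≤ x<D))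
    split : f ≡ 0 ⊎ (f ≡ 1 × 1 ℕ.≤ x) → B ≤ r * E 1 + (1ℚ - r) * E 0
    split (inj₂ (refl , 1≤x)) = mixed r (1ℚ - r) 0≤r (r≤D⇒0≤1-r/D D {{nz4 d}} x (ℕP.<⇒≤ x<D)) (p+[1-p] r)
      (frac-mono D {{nz4 d}} {1} {x} 1≤x) 0
    split (inj₁ refl) = subst (B ≤_) (+-comm ((1ℚ - r) * E 0) (r * E 1))
      (mixed (1ℚ - r) r (r≤D⇒0≤1-r/D D {{nz4 d}} x (ℕP.<⇒≤ x<D)) 0≤r (trans (+-comm (1ℚ - r) r) (p+[1-p] r))
        (subst (c ≤_) (sym 1-r) (frac-mono D {{nz4 d}} (ℕP.m<n⇒0<n∸m x<D))) 1)

  -- One time step, edge by edge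

  module _ {n : ℕ} (n<T : n ℕ.< T) {b : ℕ → ℕ} (lip : Lip b) (s base : ℕ)
           (old : Load m d) (κ : Load m d → ℚ)
           (cont : ∀ x flags → (∀ k → k ℕ.< N → flags k ≡ true → Agree n (bump s b) k x) →
                   1ℚ - failProb N (weight flags (λ _ → base)) ≤ κ x) where

    -- Counts every remaining edge whose tail lies in the block, whether or not it touches the cone.
    -- The overcount only weakens the bound and makes the count independent of n; `base` stands for
    -- the later time steps.
    todo : List (Edge m d) → ℕ → ℕ
    todo es k = edgesInBlock (block k) es ℕ.+ base

    -- Loop invariant along the edge list: if the remaining edges carry the scripted flow, the
    -- tracked cones end at the bumped profile.
    OnTrack : (ℕ → Bool) → List (Edge m d) → Load m d → Set
    OnTrack flags es acc = ∀ k → k ℕ.< N → flags k ≡ true → ∀ v → InCone n (block k) v →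
      acc v ℤ.+ ∑ℤ.∑ (contrib (flow s) v) es ≡ + profile (bump s b) (offset v)

    Touches : Vertex m d → Fin d → ℕ → Set
    Touches w j k = InCone n (block k) w ⊎ InCone n (block k) (shift+ w j)

    InCone? : ∀ k v → Dec (InCone n (block k) v)
    InCone? k v = FinP.all? λ j →
      (toℕ (lookup v j) ℕ./ L ℕP.≟ block k j) ×-dec
      ((T ℕP.≤? toℕ (lookup v j) ℕ.% L ℕ.+ n) ×-dec (toℕ (lookup v j) ℕ.% L ℕP.≤? T ℕ.+ n))

    Touches-cone : ∀ w j {k} → k ℕ.< N → Touches w j k →
      InCone (suc n) (block k) w × InCone (suc n) (block k) (shift+ w j)
    Touches-cone w j k<N (inj₁ h) =
      (λ i → Near-suc {i = lookup w i} (h i)) , InCone-shift+ {v = w} j n<T (block-< k<N) h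
    Touches-cone w j {k} k<N (inj₂ h) =
      subst (InCone (suc n) (block k)) (shift--shift+ w j) (InCone-shift- {v = shift+ w j} j n<T h) ,
      (λ i → Near-suc {i = lookup (shift+ w j) i} (h i))

    Touches-offset : ∀ w {k} → k ℕ.< N → Touches w Fin.zero k → offset (shift+ w Fin.zero) ≡ suc (offset w)
    Touches-offset w k<N (inj₁ h) = offset-shift+ {v = w} n<T k<N h
    Touches-offset w k<N (inj₂ h) =
      trans (offset-shift- {v = shift+ w Fin.zero} n<T h) (cong (λ z → suc (offset z)) (shift--shift+ w Fin.zero))

    edge-gap : ∀ w j {k} → k ℕ.< N → Touches w j k → Agree (suc n) b k old →
      Σ ℕ λ t → Σ ℕ λ a → (old w ≡ + (a ℕ.+ t)) × (old (shift+ w j) ≡ + a) × (t ℕ.≤ 3) ×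
        (flow s (w , j) ≡ 0 ⊎ (flow s (w , j) ≡ 1 × 1 ℕ.≤ t))
    edge-gap w Fin.zero k<N tch ag =
      proj₁ gap , profile b (suc (offset w))
      , trans (ag w (proj₁ cones)) (cong +_ (proj₁ (proj₂ gap)))
      , trans (ag _ (proj₂ cones)) (cong (λ o → + profile b o) (Touches-offset w k<N tch))
      , proj₂ (proj₂ (proj₂ gap))
      , Sum.map₂ (λ e → e , proj₁ (proj₂ (proj₂ gap))) (below-01 s (offset w))
      where
      cones = Touches-cone w Fin.zero k<N tch
      gap = profile-gap {b} (offset w) lip (offset<L w)
    edge-gap w (Fin.suc j) k<N tch ag =
      0 , profile b (offset w)
      , trans (ag w (proj₁ cones)) (cong +_ (sym (ℕP.+-identityʳ _)))
      , trans (ag _ (proj₂ cones)) (cong (λ o → + profile b o) (offset-shift+-suc w j))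
      , z≤n , inj₁ refl
      where cones = Touches-cone w (Fin.suc j) k<N tch

    OnTrack-follow : ∀ flags w j es acc → OnTrack flags ((w , j) ∷ es) acc →
      OnTrack flags es (move acc w (shift+ w j) (flow s (w , j)))
    OnTrack-follow flags w j es acc h k k<N fl v cv = trans
      (cong (ℤ._+ ∑ℤ.∑ (contrib (flow s) v) es) (move-transfer acc w (shift+ w j) (flow s (w , j)) v))
      (trans (ℤP.+-assoc (acc v) _ _) (h k k<N fl v cv))

    -- A transfer across an edge that no tracked cone touches is invisible to the tracked blocks.
    OnTrack-skip : ∀ flags flags′ w j es acc {x y} f →
      (∀ k → k ℕ.< N → flags′ k ≡ true → flags k ≡ true × ¬ Touches w j k) →
      (x ≡ w × y ≡ shift+ w j) ⊎ (x ≡ shift+ w j × y ≡ w) →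
      OnTrack flags ((w , j) ∷ es) acc → OnTrack flags′ es (move acc x y f)
    OnTrack-skip flags flags′ w j es acc {x} {y} f sub xy h k k<N fl v cv = begin
      move acc x y f v ℤ.+ S                             ≡⟨ cong (ℤ._+ S) (move-transfer acc x y f v) ⟩
      acc v ℤ.+ transfer x y f v ℤ.+ S                   ≡⟨ cong (λ z → acc v ℤ.+ z ℤ.+ S) (trans (zero′ xy) (sym (transfer-≢ (flow s (w , j)) v≢w v≢u))) ⟩
      acc v ℤ.+ contrib (flow s) v (w , j) ℤ.+ S         ≡⟨ ℤP.+-assoc (acc v) _ S ⟩
      acc v ℤ.+ (contrib (flow s) v (w , j) ℤ.+ S)       ≡⟨ h k k<N (proj₁ (sub k k<N fl)) v cv ⟩
      + profile (bump s b) (offset v)                    ∎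
      where
      open ≡-Reasoning
      S = ∑ℤ.∑ (contrib (flow s) v) es
      v≢w : v ≢ w
      v≢w e = proj₂ (sub k k<N fl) (inj₁ (subst (InCone n (block k)) e cv))
      v≢u : v ≢ shift+ w j
      v≢u e = proj₂ (sub k k<N fl) (inj₂ (subst (InCone n (block k)) e cv))
      zero′ : (x ≡ w × y ≡ shift+ w j) ⊎ (x ≡ shift+ w j × y ≡ w) → transfer x y f v ≡ + 0
      zero′ (inj₁ (refl , refl)) = transfer-≢ f v≢w v≢u
      zero′ (inj₂ (refl , refl)) = transfer-≢ f v≢u v≢w

    Bound : List (Edge m d) → Set
    Bound es = ∀ acc flags → (∀ k → k ℕ.< N → flags k ≡ true → Agree (suc n) b k old) → OnTrack flags es acc →
      1ℚ - failProb N (weight flags (todo es)) ≤ expStep d old es acc κ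

    -- A touched edge has its tail in block `k₀` and in no other tracked block, so exactly one
    -- exponent drops, and by exactly one. If the rounding goes wrong, `k₀` is switched off and the
    -- invariant of the other blocks does not see the edge.
    Bound-touched : ∀ w j es → Bound es → ∀ acc flags {k₀} → k₀ ℕ.< N → flags k₀ ≡ true → Touches w j k₀ →
      (∀ k → k ℕ.< N → flags k ≡ true → Agree (suc n) b k old) → OnTrack flags ((w , j) ∷ es) acc →
      1ℚ - failProb N (weight flags (todo ((w , j) ∷ es))) ≤ expStep d old ((w , j) ∷ es) acc κ
    Bound-touched w j es IH acc flags {k₀} k₀<N fl₀ tch ag tr = expStep-downhill d old w j es acc
      (subst₂ ℤ._≤_ (sym eu) (sym ew) (ℤ.+≤+ (ℕP.m≤m+n a t)))
      (rounding-bound E (flow s (w , j)) gap t≤3 flow-01 mixed)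
      where
      edge = edge-gap w j k₀<N tch (ag k₀ k₀<N fl₀)
      t = proj₁ edge
      a = proj₁ (proj₂ edge)
      ew = proj₁ (proj₂ (proj₂ edge))
      eu = proj₁ (proj₂ (proj₂ (proj₂ edge)))
      t≤3 = proj₁ (proj₂ (proj₂ (proj₂ (proj₂ edge))))
      flow-01 = proj₂ (proj₂ (proj₂ (proj₂ (proj₂ edge))))
      w-in : InCone (suc n) (block k₀) w
      w-in = proj₁ (Touches-cone w j k₀<N tch)
      E : ℕ → ℚ
      E f = expStep d old es (move acc w (shift+ w j) f) κ
      gap : ℤ.∣ old w ℤ.- old (shift+ w j) ∣ ≡ t
      gap = trans (cong₂ (λ y z → ℤ.∣ y ℤ.- z ∣) ew eu) (trans (cong ℤ.∣_∣ (ℤP.m-n≡m⊖n (a ℕ.+ t) a))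
        (trans (cong ℤ.∣_∣ (ℤP.⊖-≥ (ℕP.m≤m+n a t))) (ℕP.m+n∸m≡n a t)))
      inside : inBlock (block k₀) w ≡ 1
      inside = inBlock-cone {n = suc n} (block k₀) w w-in
      outside : ∀ k → k ≢ k₀ → inBlock (block k) w ≡ 0
      outside k ne = inBlock-off (block k) w (λ e → ne (trans (sym e) (proj₁ (w-in Fin.zero))))
      sub : ∀ k → k ℕ.< N → switchOff k₀ flags k ≡ true → flags k ≡ true × ¬ Touches w j k
      sub k k<N fl = proj₂ on , λ tch′ → proj₁ on (trans
        (sym (proj₁ (proj₁ (Touches-cone w j k<N tch′) Fin.zero))) (proj₁ (w-in Fin.zero)))
        where on = switchOff-true {k₀} {flags} fl
      mixed : ∀ p q → 0ℚ ≤ p → 0ℚ ≤ q → p + q ≡ 1ℚ → c ≤ p → ∀ f →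
        1ℚ - failProb N (weight flags (todo ((w , j) ∷ es))) ≤ p * E (flow s (w , j)) + q * E f
      mixed p q hp hq pq cp f = follow {p} {q} {e = todo ((w , j) ∷ es)} {e′ = todo es} hp hq pq cp k₀<N fl₀
        (cong (λ z → z ℕ.+ edgesInBlock (block k₀) es ℕ.+ base) inside)
        (λ k ne → cong (λ z → z ℕ.+ edgesInBlock (block k) es ℕ.+ base) (outside k ne))
        (IH _ flags ag (OnTrack-follow flags w j es acc tr))
        (IH _ (switchOff k₀ flags) (λ k k<N fl → ag k k<N (proj₁ (sub k k<N fl)))
          (OnTrack-skip flags (switchOff k₀ flags) w j es acc f sub (inj₁ (refl , refl)) tr))

    -- The loads at the ends, and hence the orientation, are unknown, but no tracked cone sees the
    -- transfer. If the tail lies in a block, that exponent shrinks, which only strengthens the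
    -- induction hypothesis.
    Bound-untouched : ∀ w j es → Bound es → ∀ acc flags →
      (∀ k → k ℕ.< N → flags k ≡ true → ¬ Touches w j k) →
      (∀ k → k ℕ.< N → flags k ≡ true → Agree (suc n) b k old) → OnTrack flags ((w , j) ∷ es) acc →
      1ℚ - failProb N (weight flags (todo ((w , j) ∷ es))) ≤ expStep d old ((w , j) ∷ es) acc κ
    Bound-untouched w j es IH acc flags none ag tr = ≤-trans
      (1-anti (failProb-anti N
        (weight-anti flags (λ k → ℕP.+-monoˡ-≤ base (ℕP.m≤n+m (edgesInBlock (block k) es) (inBlock (block k) w))))
        (weight-≤1 flags (todo es))))
      (expStep-≥ d old w j es acc
        (λ f → IH _ flags ag (OnTrack-skip flags flags w j es acc f sub (inj₁ (refl , refl)) tr))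
        (λ f → IH _ flags ag (OnTrack-skip flags flags w j es acc f sub (inj₂ (refl , refl)) tr)))
      where
      sub : ∀ k → k ℕ.< N → flags k ≡ true → flags k ≡ true × ¬ Touches w j k
      sub k k<N fl = fl , none k k<N fl

    expStep-bound : ∀ es → Bound es
    expStep-bound [] acc flags ag tr =
      cont acc flags (λ k k<N fl v cv → trans (sym (ℤP.+-identityʳ (acc v))) (tr k k<N fl v cv))
    expStep-bound ((w , j) ∷ es) acc flags ag tr = split
      (ℕP.anyUpTo? (λ k → (flags k BoolP.≟ true) ×-dec (InCone? k w ⊎-dec InCone? k (shift+ w j))) N)
      where
      split : Dec (∃ λ k → k ℕ.< N × (flags k ≡ true × Touches w j k)) →
        1ℚ - failProb N (weight flags (todo ((w , j) ∷ es))) ≤ expStep d old ((w , j) ∷ es) acc κ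
      split (yes (k , k<N , fl , tch)) = Bound-touched w j es (expStep-bound es) acc flags k<N fl tch ag tr
      split (no none) = Bound-untouched w j es (expStep-bound es) acc flags
        (λ k k<N fl tch → none (k , k<N , fl , tch)) ag tr

  -- Stationarity of the ideal process

  flat : ℕ → ℕ
  flat _ = 0

  diffuse-stationary : ∀ (ξ : RLoad m d) v y → ξ v ≡ y →
    (∀ k → ξ (shift+ v k) + ξ (shift- v k) ≡ y + y) → diffuse d ξ v ≡ y
  diffuse-stationary ξ v y e h = begin
    ξ v * (+ 1 / 2) + sumℚ (List.map (λ k → (ξ (shift+ v k) + ξ (shift- v k)) * c) (allFin d))
      ≡⟨ cong₂ _+_ (cong (_* (+ 1 / 2)) e) (trans (sumℚ-const _ (allFin d) (λ k → cong (_* c) (h k)))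
           (cong (λ n → ι n * ((y + y) * c)) (ListP.length-tabulate {n = d} (λ i → i)))) ⟩
    y * (+ 1 / 2) + ι d * ((y + y) * c)
      ≡⟨ solve 3 (λ y n c → y :* con (+ 1 / 2) :+ n :* ((y :+ y) :* c)
                   := y :* con (+ 1 / 2) :+ y :* con (+ 1 / 2) :* (c :* (con (ι 4) :* n))) refl y (ι d) c ⟩
    y * (+ 1 / 2) + y * (+ 1 / 2) * (c * (ι 4 * ι d))
      ≡⟨ cong (λ z → y * (+ 1 / 2) + y * (+ 1 / 2) * z) unit ⟩
    y * (+ 1 / 2) + y * (+ 1 / 2) * 1ℚ
      ≡⟨ solve 1 (λ y → y :* con (+ 1 / 2) :+ y :* con (+ 1 / 2) :* con 1ℚ := y) refl y ⟩
    y ∎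
    where
    open ≡-Reasoning
    open +-*-Solver
    unit : c * (ι 4 * ι d) ≡ 1ℚ
    unit = trans (cong (c *_) (sym (ι-* 4 d))) (1/-*ι D {{nz4 d}})

  Linear : ℕ → RLoad m d → Set
  Linear n ξ = ∀ k → k ℕ.< N → ∀ v → InCone n (block k) v → ξ v ≡ ι (profile flat (offset v))

  -- A linear function is harmonic along its own axis and constant along the others. The boxes
  -- shrink by one site because the neighbours have to be linear too.
  Linear-diffuse : ∀ {n} ξ → n ℕ.< T → Linear (suc n) ξ → Linear n (diffuse d ξ)
  Linear-diffuse {n} ξ n<T lin k k<N v cv =
    diffuse-stationary ξ v (ι (P o)) (lin k k<N v (λ i → Near-suc {i = lookup v i} (cv i))) sums
    where
    o = offset v
    P = profile flat
    up : ∀ j → ξ (shift+ v j) ≡ ι (P (offset (shift+ v j)))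
    up j = lin k k<N (shift+ v j) (InCone-shift+ {v = v} j n<T (block-< k<N) cv)
    down : ∀ j → ξ (shift- v j) ≡ ι (P (offset (shift- v j)))
    down j = lin k k<N (shift- v j) (InCone-shift- {v = v} j n<T cv)
    lip₀ : Lip flat
    lip₀ _ = z≤n , z≤n
    linear : ∀ o → suc o ℕ.< L → P (suc (suc o)) ℕ.+ P o ≡ P (suc o) ℕ.+ P (suc o)
    linear o lt = begin
      P (suc (suc o)) ℕ.+ P o                    ≡⟨ cong (P (suc (suc o)) ℕ.+_) (step′ o (ℕP.<⇒≤ lt)) ⟩
      P (suc (suc o)) ℕ.+ (P (suc o) ℕ.+ 2)      ≡⟨ cong (P (suc (suc o)) ℕ.+_) (ℕP.+-comm (P (suc o)) 2) ⟩
      P (suc (suc o)) ℕ.+ (2 ℕ.+ P (suc o))      ≡⟨ sym (ℕP.+-assoc (P (suc (suc o))) 2 (P (suc o))) ⟩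
      P (suc (suc o)) ℕ.+ 2 ℕ.+ P (suc o)        ≡⟨ cong (ℕ._+ P (suc o)) (sym (step′ (suc o) lt)) ⟩
      P (suc o) ℕ.+ P (suc o)                    ∎
      where
      open ≡-Reasoning
      step′ : ∀ o → o ℕ.< L → P o ≡ P (suc o) ℕ.+ 2
      step′ o lt = proj₁ (proj₂ (profile-gap {flat} o lip₀ lt))
    sums : ∀ j → ξ (shift+ v j) + ξ (shift- v j) ≡ ι (P o) + ι (P o)
    sums Fin.zero = begin
      ξ (shift+ v Fin.zero) + ξ (shift- v Fin.zero)
        ≡⟨ cong₂ _+_ (up Fin.zero) (down Fin.zero) ⟩
      ι (P (offset (shift+ v Fin.zero))) + ι (P o₋)
        ≡⟨ cong (λ z → ι (P z) + ι (P o₋)) (trans (offset-shift+ {v = v} n<T k<N cv) (cong suc e)) ⟩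
      ι (P (suc (suc o₋))) + ι (P o₋)
        ≡⟨ sym (ι-+ (P (suc (suc o₋))) (P o₋)) ⟩
      ι (P (suc (suc o₋)) ℕ.+ P o₋)
        ≡⟨ cong ι (linear o₋ (subst (ℕ._< L) e (offset<L v))) ⟩
      ι (P (suc o₋) ℕ.+ P (suc o₋))
        ≡⟨ ι-+ (P (suc o₋)) (P (suc o₋)) ⟩
      ι (P (suc o₋)) + ι (P (suc o₋))
        ≡⟨ cong (λ z → ι (P z) + ι (P z)) (sym e) ⟩
      ι (P o) + ι (P o) ∎
      where
      open ≡-Reasoning
      o₋ = offset (shift- v Fin.zero)
      e : offset v ≡ suc o₋
      e = offset-shift- {v = v} n<T cv
    sums (Fin.suc j) = cong₂ _+_
      (trans (up (Fin.suc j)) (cong (λ z → ι (P z)) (offset-shift+-suc v j)))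
      (trans (down (Fin.suc j)) (cong (λ z → ι (P z)) (offset-shift--suc v j)))

  centre : ∀ k → k ℕ.< N → Σ (Vertex m d) λ v → (offset v ≡ T) × (∀ n → InCone n (block k) v)
  centre k k<N = v , trans (cong (ℕ._% L) (FinP.toℕ-fromℕ< (inside k k<N))) (%-block T k T<L) , inCone
    where
    T<L : T ℕ.< L
    T<L = s≤s (ℕP.m≤m+n T T)
    inside : ∀ j → j ℕ.< N → T ℕ.+ j ℕ.* L ℕ.< m
    inside j j<N = ℕP.<-≤-trans (ℕP.+-monoˡ-< (j ℕ.* L) T<L) (ℕP.≤-trans (ℕP.*-monoˡ-≤ L j<N) fits)
    site : ∀ j → j ℕ.< N → Fin m
    site j j<N = fromℕ< (inside j j<N)
    near : ∀ n j (j<N : j ℕ.< N) → Near n j (site j j<N)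
    near n j j<N =
      trans (cong (ℕ._/ L) e) (/-block T j T<L)
      , subst (λ z → T ℕ.≤ z ℕ.+ n) (sym r) (ℕP.m≤m+n T n)
      , subst (ℕ._≤ T ℕ.+ n) (sym r) (ℕP.m≤m+n T n)
      where
      e : toℕ (site j j<N) ≡ T ℕ.+ j ℕ.* L
      e = FinP.toℕ-fromℕ< (inside j j<N)
      r : toℕ (site j j<N) ℕ.% L ≡ T
      r = trans (cong (ℕ._% L) e) (%-block T j T<L)
    0<N : 0 ℕ.< N
    0<N = ℕP.≤-<-trans z≤n k<N
    v : Vertex m d
    v = site k k<N ∷ replicate d′ (site 0 0<N)
    inCone : ∀ n → InCone n (block k) v
    inCone n Fin.zero    = near n k k<N
    inCone n (Fin.suc j) = subst (Near n 0) (sym (VecP.lookup-replicate j (site 0 0<N))) (near n 0 0<N)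

  -- From the script to the hitting probability

  module _ {K : ℚ} {p q W : ℕ} (threshold : K * ℤtoℚ (+ (⌊log₂ (m ℕ.^ d) ⌋ ℕ.^ p)) ≤ ι (W ℕ.^ q)) where

    deviation : ∀ {n b k x ξ} → W ℕ.≤ b T → k ℕ.< N → Agree n b k x → Linear n ξ → bigDev m d K p q x ξ ≡ true
    deviation {n} {b} {k} {x} {ξ} W≤ k<N ag lin =
      bigDev-witness d {K} {p} {q} {x} {ξ} v (begin
        K * ℤtoℚ (+ (⌊log₂ (m ℕ.^ d) ⌋ ℕ.^ p))     ≤⟨ threshold ⟩
        ι (W ℕ.^ q)                                ≤⟨ ι-mono {W ℕ.^ q} {b T ℕ.^ q} (ℕP.^-monoˡ-≤ q W≤) ⟩
        ι (b T ℕ.^ q)                              ≡⟨ sym (ι-pow (b T) q) ⟩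
        powℚ (ι (b T)) q                           ≡⟨ cong (λ z → powℚ z q) (sym (0≤p⇒∣p∣≡p (0≤ι (b T)))) ⟩
        powℚ ℚ.∣ ι (b T) ∣ q                       ≡⟨ cong (λ z → powℚ ℚ.∣ z ∣ q) (sym (diff v (proj₁ (proj₂ site)) (proj₂ (proj₂ site) n))) ⟩
        powℚ ℚ.∣ ℤtoℚ (x v) - ξ v ∣ q              ∎)
      where
      open ≤-Reasoning
      open +-*-Solver
      site = centre k k<N
      v = proj₁ site
      A = 2 ℕ.* (L ℕ.∸ T)
      diff : ∀ v → offset v ≡ T → InCone n (block k) v → ℤtoℚ (x v) - ξ v ≡ ι (b T)
      diff v o≡T cv = trans
        (cong₂ _-_
          (trans (cong ℤtoℚ (trans (ag v cv) (cong (λ o → + profile b o) o≡T))) (ι-+ A (b T)))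
          (trans (lin k k<N v cv) (trans (cong (λ o → ι (profile flat o)) o≡T) (ι-+ A 0))))
        (solve 2 (λ a b → (a :+ b) :- (a :+ con 0ℚ) := b) refl (ι A) (ι (b T)))

    volume : ℕ
    volume = d ℕ.* L ℕ.^ d

    -- Induction on the script. At its end either some block is still tracked and its centre
    -- deviates enough, so that `hitProb` is 1, or all weights vanish and the bound reads 0. Each
    -- earlier step spends `volume` outcomes per block through `expStep-bound`.
    hit-bound : ∀ {b n} → Path T W b n → n ℕ.≤ T → ∀ x ξ flags →
      (∀ k → k ℕ.< N → flags k ≡ true → Agree n b k x) → Linear n ξ →
      1ℚ - failProb N (weight flags (λ _ → n ℕ.* volume)) ≤ hitProb d K p q n x ξ
    hit-bound {b} {n} (done W≤) n≤T x ξ flags ag lin = split (ℕP.anyUpTo? (λ k → flags k BoolP.≟ true) N)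
      where
      V = failProb N (weight flags (λ _ → n ℕ.* volume))
      split : Dec (∃ λ k → k ℕ.< N × flags k ≡ true) → 1ℚ - V ≤ hitProb d K p q n x ξ
      split (yes (k , k<N , fl)) =
        subst (1ℚ - V ≤_) (sym (hitProb-bigDev d {K} {p} {q} n (deviation {b = b} W≤ k<N (ag k k<N fl) lin)))
          (1-≤1 (failProb-nonneg N (weight-≤1 flags (λ _ → n ℕ.* volume))))
      split (no none) =
        subst (_≤ hitProb d K p q n x ξ) (sym (trans (cong (λ z → 1ℚ - z) (failProb-none N off)) (+-inverseʳ 1ℚ)))
          (hitProb-nonneg d K p q n x ξ)
        where
        off : ∀ k → k ℕ.< N → weight flags (λ _ → n ℕ.* volume) k ≡ 0ℚ
        off k k<N = cong (λ z → weigh z (n ℕ.* volume)) (BoolP.¬-not (λ fl → none (k , k<N , fl)))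
    hit-bound {b} {suc n} (step s lip path) n<T x ξ flags ag lin = by-cases refl
      where
      V = failProb N (weight flags (λ _ → suc n ℕ.* volume))
      κ : Load m d → ℚ
      κ x′ = hitProb d K p q n x′ (diffuse d ξ)
      cont : ∀ x flags → (∀ k → k ℕ.< N → flags k ≡ true → Agree n (bump s b) k x) →
             1ℚ - failProb N (weight flags (λ _ → n ℕ.* volume)) ≤ κ x
      cont x flags ag = hit-bound path (ℕP.<⇒≤ n<T) x (diffuse d ξ) flags ag (Linear-diffuse ξ n<T lin)
      start : OnTrack n<T lip s (n ℕ.* volume) x κ cont flags (edges m d) x
      start k k<N fl v cv = trans
        (cong₂ ℤ._+_ (ag k k<N fl v (λ i → Near-suc {i = lookup v i} (cv i))) (flow-divergence {v = v} s n<T cv))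
        (cong +_ (ℕP.+-assoc (2 ℕ.* (L ℕ.∸ offset v)) (b (offset v)) (δ s (offset v))))
      one-step : 1ℚ - V ≤ expStep d x (edges m d) x κ
      one-step = ≤-trans
        (1-anti (failProb-anti N
          (weight-anti flags {λ _ → suc n ℕ.* volume} (λ k → ℕP.+-monoˡ-≤ (n ℕ.* volume) (edgesInBlock-bound d (block k))))
          (weight-≤1 flags (λ k → edgesInBlock (block k) (edges m d) ℕ.+ n ℕ.* volume))))
        (expStep-bound n<T lip s (n ℕ.* volume) x κ cont (edges m d) x flags ag start)
      by-cases : ∀ {B} → B ≡ bigDev m d K p q x ξ →
        1ℚ - V ≤ (if B then 1ℚ else expStep d x (edges m d) x κ)
      by-cases {true}  _ = 1-≤1 (failProb-nonneg N (weight-≤1 flags (λ _ → suc n ℕ.* volume)))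
      by-cases {false} _ = one-step

-- Choice of the constants

large-inverse : ∀ ε → 0ℚ < ε → Σ ℕ λ I → (1 ℕ.≤ I) × (1ℚ ≤ ε * ι I)
large-inverse ε@(mkℚ (+ zero) _ _) pos with () ← ℤ.Positive.pos (positive pos)
large-inverse ε@(mkℚ ℤ.-[1+ _ ] _ _) pos with () ← ℤ.Positive.pos (positive pos)
-- The field `e` is the denominator minus one, so I is the denominator of ε, and ε I is its
-- numerator.
large-inverse ε@(mkℚ (+ suc n) e _) pos = suc e , s≤s z≤n , (begin
  1ℚ                                    ≡⟨ sym (frac-self (suc e)) ⟩
  + suc e / suc e                       ≤⟨ frac-mono (suc e) {suc e} {suc n ℕ.* suc e} (ℕP.m≤m+n (suc e) (n ℕ.* suc e)) ⟩
  + (suc n ℕ.* suc e) / suc e           ≡⟨ sym (frac-*ι (suc e) (suc n) (suc e)) ⟩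
  + suc n / suc e * ι (suc e)           ≡⟨ cong (_* ι (suc e)) (↥p/↧p≡p ε) ⟩
  ε * ι (suc e)                         ∎)
  where open ≤-Reasoning

-- With x = 1/J and N ≥ I J the expected number N x of successes is at least I, and `bernoulli`
-- turns this into a failure probability of at most 1/I ≤ ε.
failProb-small : ∀ {x ε I J} N → 0ℚ ≤ x → x ≤ 1ℚ → x * ι J ≡ 1ℚ → I ℕ.* J ℕ.≤ N →
  1 ℕ.≤ I → 1ℚ ≤ ε * ι I → failProb N (λ _ → x) ≤ ε
failProb-small {x} {ε} {I@(suc i)} {J} N 0≤x x≤1 unit IJ≤N _ 1≤εI = *-cancelʳ-≤-pos (ι I) {{ιI-pos}} (begin
  F * ι I                ≤⟨ *-mono-ʳ (failProb-nonneg N (λ _ → x≤1)) I≤1+Nx ⟩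
  F * (1ℚ + ι N * x)     ≤⟨ bernoulli N 0≤x x≤1 ⟩
  1ℚ                     ≤⟨ 1≤εI ⟩
  ε * ι I                ∎)
  where
  open ≤-Reasoning
  F = failProb N (λ _ → x)
  ιI-pos : ℚ.Positive (ι I)
  ιI-pos = normalize-pos I 1
  I≤1+Nx : ι I ≤ 1ℚ + ι N * x
  I≤1+Nx = begin
    ι I                  ≡⟨ sym (trans (cong (ι I *_) unit) (*-identityʳ (ι I))) ⟩
    ι I * (x * ι J)      ≡⟨ (let open +-*-Solver in solve 3 (λ a x b → a :* (x :* b) := a :* b :* x) refl (ι I) x (ι J)) ⟩
    ι I * ι J * x        ≡⟨ cong (_* x) (sym (ι-* I J)) ⟩
    ι (I ℕ.* J) * x      ≤⟨ *-mono-ˡ 0≤x (ι-mono {I ℕ.* J} {N} IJ≤N) ⟩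
    ι N * x              ≡⟨ sym (+-identityˡ (ι N * x)) ⟩
    0ℚ + ι N * x         ≤⟨ +-monoˡ-≤ (ι N * x) 0≤1 ⟩
    1ℚ + ι N * x         ∎

mainTheorem4 : (d : ℕ) → .{{_ : NonZero d}} →
    Σ ℚ λ K → Σ ℕ λ p → Σ ℕ λ q → (0ℚ < K) × (p > 0) × (q > 0) ×
    Σ ((m : ℕ) → Vertex m d → ℕ) λ x0 →
    (ε : ℚ) → 0ℚ < ε →
    Σ ℕ λ M → (m : ℕ) → m ≥ M →
    Σ ℕ λ T → 1ℚ - ε ≤ devProb m d K p q T (x0 m)
mainTheorem4 (suc d′) = K , 1 , q , K-pos , s≤s z≤n , s≤s z≤n , x0 , bound
  where
  open Scale d′
  q B : ℕ
  q = 2 ℕ.* suc d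
  B = 2 ℕ.* (suc (D ℕ.* d) ℕ.* 20 ℕ.^ suc d) ℕ.* d

  instance
    B≢0 : NonZero B
    B≢0 = ℕP.m*n≢0 (2 ℕ.* (suc (D ℕ.* d) ℕ.* 20 ℕ.^ suc d)) d
      {{ℕP.m*n≢0 2 (suc (D ℕ.* d) ℕ.* 20 ℕ.^ suc d) {{_}} {{ℕP.m*n≢0 (suc (D ℕ.* d)) (20 ℕ.^ suc d) {{_}} {{ℕP.m^n≢0 20 (suc d)}}}}}}

  K : ℚ
  K = + 1 / B

  K-pos : 0ℚ < K
  K-pos = positive⁻¹ K {{normalize-pos 1 B}}

  T blocks : ℕ → ℕ
  T m = time (height m)
  blocks m = m ℕ./ side (height m)

  fits : ∀ m → blocks m ℕ.* side (height m) ℕ.≤ m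
  fits m = m/n*n≤m m (side (height m))

  module Block (m : ℕ) = Blocks d′ m (T m) (blocks m) (fits m)

  x0 : (m : ℕ) → Vertex m d → ℕ
  -- The offset is taken modulo the side of a block, so this is a periodic sawtooth, constant in all
  -- coordinates but the first.
  x0 m v = Block.profile m (λ _ → 0) (Block.offset m v)

  bound : (ε : ℚ) → 0ℚ < ε → Σ ℕ λ M → (m : ℕ) → m ≥ M → Σ ℕ λ T → 1ℚ - ε ≤ devProb m d K 1 q T (x0 m)
  -- From this m on the height I is admissible, so `height m` is at least I.
  bound ε ε-pos = 2 ℕ.^ (2 ℕ.* h I) , λ m large → T m , (begin
    1ℚ - ε
      ≤⟨ 1-anti (failProb-small {ε = ε} (blocks m) (powℚ-nonneg (Block.0≤c m) (Block.c≤1 m) (budget (height m)))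
           (powℚ-≤1 (Block.0≤c m) (Block.c≤1 m) (budget (height m)))
           (powℚ-unit {Block.c m} {D} (budget (height m)) (1/-*ι D {{nz4 d}}))
           (many-blocks {I} {m} large 1≤I) 1≤I 1≤εI) ⟩
    1ℚ - failProb (blocks m) (λ _ → powℚ (Block.c m) (budget (height m)))
      ≤⟨ Block.hit-bound m (threshold m large 1≤I) (path (T m) (height m)) ℕP.≤-refl
           (λ v → + x0 m v) (λ v → ℤtoℚ (+ x0 m v)) (λ _ → true) (λ _ _ _ _ _ → refl) (λ _ _ _ _ → refl) ⟩
    devProb m d K 1 q (T m) (x0 m) ∎)
    where
    open ≤-Reasoning
    inverse = large-inverse ε ε-pos
    I = proj₁ inverse
    1≤I = proj₁ (proj₂ inverse)
    1≤εI = proj₂ (proj₂ inverse)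
    threshold : ∀ m → 2 ℕ.^ (2 ℕ.* h I) ℕ.≤ m → 1 ℕ.≤ I → K * ℤtoℚ (+ (⌊log₂ (m ℕ.^ d) ⌋ ℕ.^ 1)) ≤ ι (height m ℕ.^ q)
    threshold m large 1≤I = begin
      K * ι (ℓ ℕ.^ 1)           ≡⟨ cong (λ z → K * ι z) (ℕP.^-identityʳ ℓ) ⟩
      K * ι ℓ                   ≤⟨ *-mono-ʳ (<⇒≤ K-pos) (ι-mono {ℓ} {B ℕ.* w} (log-≤ {I} {m} large 1≤I)) ⟩
      K * ι (B ℕ.* w)           ≡⟨ cong (K *_) (ι-* B w) ⟩
      K * (ι B * ι w)           ≡⟨ sym (*-assoc K (ι B) (ι w)) ⟩
      K * ι B * ι w             ≡⟨ cong (_* ι w) (1/-*ι B) ⟩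
      1ℚ * ι w                  ≡⟨ *-identityˡ (ι w) ⟩
      ι w                       ∎
      where
      ℓ = ⌊log₂ (m ℕ.^ d) ⌋
      w = height m ℕ.^ q
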